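{- Let $f\colon[0,1]\to\mathbb R$ be real analytic. Then for every $\varepsilon>0$ there exists an integer $R\ge 0$ such that for all integers $r\ge R$, $m\ge 1$, $b\ge 1$ and every $B=(B_1,\dots,B_b)\in\mathrm{PTE}(m,b,r)$, the quantities $$c_j=\sum_{i\in B_j}\int_{(i-1)/m}^{i/m} f(x)\,dx,\qquad j=1,\dots,b,$$ satisfy $|c_i-c_j|<\varepsilon$ for all $i,j\in\{1,\dots,b\}$.
   Context: $[m]=\{1,\dots,m\}$. A partition of $[m]$ into $b$ blocks is an ordered list $(B_1,\dots,B_b)$ of pairwise disjoint (possibly empty) subsets with union $[m]$. It is $r$-regular if $\sum_{x\in B_1}x^k=\dots=\sum_{x\in B_b}x^k$ for all $k=0,1,\dots,r$. $\mathrm{PTE}(m,b,r)$ denotes the set of $r$-regular partitions of $[m]$ into $b$ blocks. -}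

module Defs where

open import Algebra.Bundles using (CommutativeMonoid; CommutativeRing)
import Algebra.Construct.NaturalChoice.Max as Max
import Algebra.Properties.CommutativeMonoid.Sum as Sum
import Algebra.Properties.Semiring.Exp as Exp
import Algebra.Properties.Semiring.Mult as Mult
open import Axiom.ExcludedMiddle using (ExcludedMiddle)
open import Data.Bool.Base using (if_then_else_)
open import Data.Fin.Base using (Fin; zero; suc; toℕ; fromℕ; inject₁)
open import Data.Fin.Subset using (Subset; _∈_; _∩_; Empty)
open import Data.Fin.Subset.Properties using (_∈?_)
open import Data.Nat.Base as ℕ using (ℕ; suc)
open import Data.Nat.Properties using (+-0-commutativeMonoid)
open import Data.Product.Base using (Σ; ∃; _×_; _,_; proj₁)
open import Function.Bundles using (Func)
open import Level using (0ℓ)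
open import Relation.Binary.Bundles using (Setoid; TotalOrder)
open import Relation.Binary.Core using (Rel)
import Relation.Binary.Construct.NonStrictToStrict as ToStrict
import Relation.Binary.Construct.On as On
open import Relation.Binary.PropositionalEquality.Core using (_≡_; _≢_)
open import Relation.Binary.Structures using (IsTotalOrder)
open import Relation.Nullary.Decidable.Core using (does; yes; no)
open import Relation.Nullary.Negation.Core using (¬_)

module SubsetSum (M : CommutativeMonoid 0ℓ 0ℓ) where
  open CommutativeMonoid M using (Carrier; ε)
  open Sum M using (sum)

  ∑∈ : ∀ {n} → Subset n → (Fin n → Carrier) → Carrier
  ∑∈ S g = sum (λ i → if does (i ∈? S) then g i else ε)

-- The element x of [m] = {1,…,m} is represented by the i : Fin m with
-- x = suc (toℕ i).

powerSum : ∀ {m} → Subset m → ℕ → ℕ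
powerSum S k = SubsetSum.∑∈ +-0-commutativeMonoid S (λ i → suc (toℕ i) ℕ.^ k)

record IsPartition {m b : ℕ} (B : Fin b → Subset m) : Set where
  field
    disjoint : ∀ {i j} → i ≢ j → Empty (B i ∩ B j)
    covering : ∀ x → ∃ λ j → x ∈ B j

IsRegular : ∀ {m b} → ℕ → (Fin b → Subset m) → Set
IsRegular r B = ∀ k → k ℕ.≤ r → ∀ i j → powerSum (B i) k ≡ powerSum (B j) k

record PTE (m b r : ℕ) : Set where
  field
    block       : Fin b → Subset m
    isPartition : IsPartition block
    isRegular   : IsRegular r block

-- The real numbers are given by their classical axiomatisation, which
-- determines them up to unique isomorphism.  The value of _⁻¹ at 0# is
-- left unspecified.

record CompleteOrderedField : Set₁ where
  infix 8 _⁻¹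
  infix 4 _≤_
  field
    commutativeRing : CommutativeRing 0ℓ 0ℓ

  open CommutativeRing commutativeRing public renaming (zero to *-zero)

  field
    _≤_          : Rel Carrier 0ℓ
    isTotalOrder : IsTotalOrder _≈_ _≤_
    +-monoʳ-≤    : ∀ z {x y} → x ≤ y → (z + x) ≤ (z + y)
    *-nonNeg     : ∀ {x y} → 0# ≤ x → 0# ≤ y → 0# ≤ (x * y)
    _⁻¹          : Carrier → Carrier
    *-inverseʳ   : ∀ {x} → ¬ (x ≈ 0#) → (x * x ⁻¹) ≈ 1#
    0≉1          : ¬ (0# ≈ 1#)

  IsUpperBound : (Carrier → Set) → Carrier → Set
  IsUpperBound P u = ∀ {x} → P x → x ≤ u

  field
    sup : (P : Carrier → Set) → ∃ P → ∃ (IsUpperBound P) →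
          ∃ λ s → IsUpperBound P s × (∀ {u} → IsUpperBound P u → s ≤ u)

  totalOrder : TotalOrder 0ℓ 0ℓ 0ℓ
  totalOrder = record { isTotalOrder = isTotalOrder }

  open ToStrict _≈_ _≤_ public using (_<_)
  open Max totalOrder public using (_⊔_)
  open Sum +-commutativeMonoid public using (sum)
  open Exp semiring public using (_^_)
  open SubsetSum +-commutativeMonoid public using (∑∈)
  open Mult semiring using () renaming (_×_ to _·_)

  ∣_∣ : Carrier → Carrier
  ∣ x ∣ = x ⊔ (- x)

  infixl 7 _/ℕ_
  _/ℕ_ : ℕ → ℕ → Carrier
  k /ℕ m = (k · 1#) * (m · 1#) ⁻¹

module Analysis (ℝ : CompleteOrderedField) where
  open CompleteOrderedField ℝ

  [0,1] : Set
  [0,1] = Σ Carrier λ x → 0# ≤ x × x ≤ 1#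

  [0,1]-setoid : Setoid 0ℓ 0ℓ
  [0,1]-setoid = On.setoid {B = [0,1]} setoid proj₁

  UnitFunction : Set
  UnitFunction = Func [0,1]-setoid setoid

  infix 4 _⟶_
  _⟶_ : (ℕ → Carrier) → Carrier → Set
  s ⟶ l = ∀ ε → 0# < ε → ∃ λ N → ∀ n → N ℕ.≤ n → ∣ s n - l ∣ < ε

  -- At every point of [0,1], endpoints included, f agrees with a convergent
  -- power series on a relative neighbourhood in [0,1].
  RealAnalytic : UnitFunction → Set
  RealAnalytic f =
    ∀ (c : [0,1]) → ∃ λ (ρ : Carrier) → 0# < ρ ×
    ∃ λ (a : ℕ → Carrier) →
    ∀ (x : [0,1]) → ∣ proj₁ x - proj₁ c ∣ < ρ →
    (λ n → sum {n} (λ k → a (toℕ k) * (proj₁ x - proj₁ c) ^ toℕ k)) ⟶ Func.to f x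

  record TaggedPartition (a b : Carrier) : Set where
    field
      size  : ℕ
      point : Fin (suc size) → Carrier
      tag   : Fin size → [0,1]
      first : point zero ≈ a
      last  : point (fromℕ size) ≈ b
      left  : ∀ k → point (inject₁ k) ≤ proj₁ (tag k)
      right : ∀ k → proj₁ (tag k) ≤ point (suc k)

    width : Fin size → Carrier
    width k = point (suc k) - point (inject₁ k)

  riemannSum : UnitFunction → ∀ {a b} → TaggedPartition a b → Carrier
  riemannSum f P = sum (λ k → Func.to f (tag k) * width k)
    where open TaggedPartition P

  -- Only meaningful for 0 ≤ a ≤ b ≤ 1: otherwise [a,b] need not have fine
  -- partitions with tags in [0,1].
  HasIntegral : UnitFunction → Carrier → Carrier → Carrier → Set
  HasIntegral f a b v =
    ∀ ε → 0# < ε → ∃ λ δ → 0# < δ ×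
    (∀ (P : TaggedPartition a b) → (∀ k → TaggedPartition.width P k < δ) →
     ∣ riemannSum f P - v ∣ < ε)

  -- The Riemann integral as a total operation, with value 0# when f is not
  -- integrable on [a,b].
  ∫ : ExcludedMiddle 0ℓ → UnitFunction → Carrier → Carrier → Carrier
  ∫ em f a b with em {∃ (HasIntegral f a b)}
  ... | yes (v , _) = v
  ... | no  _       = 0#

  blockIntegral : ExcludedMiddle 0ℓ → UnitFunction →
                  ∀ {m b r} → PTE m b r → Fin b → Carrier
  blockIntegral em f {m} B j =
    ∑∈ (PTE.block B j) (λ i → ∫ em f (toℕ i /ℕ m) (suc (toℕ i) /ℕ m))

{-# OPTIONS --safe #-}

-- Only continuity of f matters.  By the Weierstrass theorem f is uniformly
-- e-close to a (Bernstein) polynomial p of some degree n; let F be an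
-- antiderivative of p.  The integral of f over [(i-1)/m, i/m] is then
-- e/m-close to F(i/m) - F((i-1)/m), a polynomial in i of degree at most n + 1,
-- whose sum over a block is the same for all blocks as soon as r ≥ n + 1.
-- Hence the c_j are 2e-close to one another, whatever m and b are.

module Submission where

open import Defs
open import Axiom.ExcludedMiddle using (ExcludedMiddle)
open import Data.Fin.Base using (Fin)
open import Data.Nat.Base using (ℕ; _≥_)
open import Data.Product.Base using (∃)
open import Level using (0ℓ)

open import Algebra.Solver.Ring.AlmostCommutativeRing using (fromCommutativeRing; _-Raw-AlmostCommutative⟶_)
import Algebra.Construct.NaturalChoice.Max as Max
import Algebra.Properties.CommutativeMonoid.Sum as MonoidSum
import Algebra.Properties.CommutativeSemiring.Exp as Exp
import Algebra.Properties.Ring as RingProperties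
import Algebra.Properties.Semiring.Mult as Mult
import Algebra.Properties.Semiring.Mult.TCOptimised as Mult′
import Algebra.Properties.Semiring.Sum as Sum
import Algebra.Solver.Ring as RingSolver
open import Data.Bool.Base using (true; false; if_then_else_)
open import Data.Fin.Base using (zero; suc; toℕ; fromℕ; inject₁)
open import Data.Fin.Properties using (toℕ-inject₁; toℕ≤pred[n]; toℕ-fromℕ; toℕ<n)
open import Data.Fin.Subset using (Subset)
open import Data.Fin.Subset.Properties using (_∈?_)
open import Data.Integer.Base as ℤ using (ℤ; +_; -[1+_])
import Data.Integer.Properties as ℤ
open import Data.Maybe.Base using (Maybe; just; nothing)
open import Data.Nat.Base as ℕ using (zero; suc)
import Data.Nat.Properties as ℕ
open import Data.Product.Base using (∃₂; _×_; _,_; proj₁; proj₂)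
open import Data.Sign.Base as Sign using (Sign)
open import Data.Sum.Base using (inj₁; inj₂; [_,_]′)
open import Function.Base using (_∘_)
open import Function.Bundles using (Func)
open import Relation.Binary.Bundles using (TotalOrder)
import Relation.Binary.Construct.NonStrictToStrict as ToStrict
import Relation.Binary.PropositionalEquality.Core as ≡
import Relation.Binary.Reasoning.PartialOrder as PosetReasoning
open import Relation.Nullary.Decidable.Core using (does; yes; no)
open import Relation.Nullary.Negation.Core using (¬_; contradiction)

-- Completeness is available through suprema only, so supremum arguments take the place of both the
-- compactness of [0,1] and the convergence of Cauchy sequences. `∫` is `0#` unless integrability is
-- proved, so the polynomial approximations serve twice: they make the Riemann sums converge, and
-- they bound the distance from the integral to the increment of an antiderivative. That distance
-- stays proportional to the length of the interval, and the polynomial is chosen before the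
-- interval; otherwise the final bound would depend on `m`. Polynomials are never put in monomial
-- form: Bernstein polynomials, their antiderivatives and the degree count all follow one recursion,
-- which splits off a factor 1 - x or x.

module Proof (em : ExcludedMiddle 0ℓ) (ℝ : CompleteOrderedField) where

  open CompleteOrderedField ℝ
  open TotalOrder totalOrder using (total; antisym; poset)
    renaming (refl to ≤-refl; trans to ≤-trans; reflexive to ≤-reflexive; ≤-respˡ-≈ to ≤-respˡ; ≤-respʳ-≈ to ≤-respʳ)

  -- Coefficients in ℤ, whose equality computes, let the solver see cancellation.
  module Solver where
    open Mult′ semiring using (×1-homo-*; ×-homo-+; 1+×) renaming (_×_ to _×′_)
    open RingProperties ring using (-‿distribˡ-*; -‿distribʳ-*; -‿involutive; -0#≈0#; -‿+-comm)
    open import Relation.Binary.Reasoning.Setoid setoid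

    -- The optimised multiple `_×′_` makes the constants `:0`, `:1` and `:2` reduce to `0#`, `1#`
    -- and `1# + 1#`, so that solved identities fit the goals verbatim.
    ⟦_⟧ℤ : ℤ → Carrier
    ⟦ + n      ⟧ℤ = n ×′ 1#
    ⟦ -[1+ n ] ⟧ℤ = - (suc n ×′ 1#)

    [x+y]-[x+z] : ∀ x y z → y - z ≈ (x + y) - (x + z)
    [x+y]-[x+z] x y z = begin
      y - z                   ≈⟨ +-identityˡ _ ⟨
      0# + (y - z)            ≈⟨ +-congʳ (-‿inverseʳ x) ⟨
      (x - x) + (y - z)       ≈⟨ +-assoc _ _ _ ⟩
      x + (- x + (y - z))     ≈⟨ +-congˡ (+-assoc _ _ _) ⟨
      x + ((- x + y) - z)     ≈⟨ +-congˡ (+-congʳ (+-comm _ _)) ⟩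
      x + ((y - x) - z)       ≈⟨ +-congˡ (+-assoc _ _ _) ⟩
      x + (y + (- x - z))     ≈⟨ +-assoc _ _ _ ⟨
      (x + y) + (- x - z)     ≈⟨ +-congˡ (-‿+-comm _ _) ⟩
      (x + y) - (x + z)       ∎

    ⊖-homo : ∀ m n → ⟦ m ℤ.⊖ n ⟧ℤ ≈ m ×′ 1# - n ×′ 1#
    ⊖-homo zero    zero    = sym (-‿inverseʳ 0#)
    ⊖-homo (suc m) zero    = sym (trans (+-congˡ -0#≈0#) (+-identityʳ _))
    ⊖-homo zero    (suc n) = sym (+-identityˡ _)
    ⊖-homo (suc m) (suc n) = begin
      ⟦ suc m ℤ.⊖ suc n ⟧ℤ               ≡⟨ ≡.cong ⟦_⟧ℤ (ℤ.[1+m]⊖[1+n]≡m⊖n m n) ⟩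
      ⟦ m ℤ.⊖ n ⟧ℤ                       ≈⟨ ⊖-homo m n ⟩
      m ×′ 1# - n ×′ 1#                  ≈⟨ [x+y]-[x+z] 1# _ _ ⟩
      (1# + m ×′ 1#) - (1# + n ×′ 1#)    ≈⟨ +-cong (1+× m 1#) (-‿cong (1+× n 1#)) ⟨
      suc m ×′ 1# - suc n ×′ 1#          ∎

    +-homo : ∀ i j → ⟦ i ℤ.+ j ⟧ℤ ≈ ⟦ i ⟧ℤ + ⟦ j ⟧ℤ
    +-homo (+ m)      (+ n)      = ×-homo-+ 1# m n
    +-homo (+ m)      -[1+ n ]   = ⊖-homo m (suc n)
    +-homo -[1+ m ]   (+ n)      = trans (⊖-homo n (suc m)) (+-comm _ _)
    +-homo -[1+ m ]   -[1+ n ]   = begin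
      - (suc (suc (m ℕ.+ n)) ×′ 1#)      ≡⟨ ≡.cong (λ k → - (suc k ×′ 1#)) (ℕ.+-suc m n) ⟨
      - ((suc m ℕ.+ suc n) ×′ 1#)        ≈⟨ -‿cong (×-homo-+ 1# (suc m) (suc n)) ⟩
      - (suc m ×′ 1# + suc n ×′ 1#)      ≈⟨ -‿+-comm _ _ ⟨
      - (suc m ×′ 1#) - suc n ×′ 1#      ∎

    signed : Sign → Carrier → Carrier
    signed Sign.+ x = x
    signed Sign.- x = - x

    ◃-homo : ∀ s n → ⟦ s ℤ.◃ n ⟧ℤ ≈ signed s (n ×′ 1#)
    ◃-homo Sign.+ zero    = refl
    ◃-homo Sign.- zero    = sym -0#≈0#
    ◃-homo Sign.+ (suc n) = refl
    ◃-homo Sign.- (suc n) = refl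

    *-homo : ∀ i j → ⟦ i ℤ.* j ⟧ℤ ≈ ⟦ i ⟧ℤ * ⟦ j ⟧ℤ
    *-homo (+ m)    (+ n)    = trans (◃-homo Sign.+ (m ℕ.* n)) (×1-homo-* m n)
    *-homo (+ m)    -[1+ n ] = begin
      _                                ≈⟨ ◃-homo Sign.- (m ℕ.* suc n) ⟩
      - ((m ℕ.* suc n) ×′ 1#)          ≈⟨ -‿cong (×1-homo-* m (suc n)) ⟩
      - (m ×′ 1# * (suc n ×′ 1#))      ≈⟨ -‿distribʳ-* _ _ ⟩
      m ×′ 1# * - (suc n ×′ 1#)        ∎
    *-homo -[1+ m ] (+ n)    = begin
      _                                ≈⟨ ◃-homo Sign.- (suc m ℕ.* n) ⟩
      - ((suc m ℕ.* n) ×′ 1#)          ≈⟨ -‿cong (×1-homo-* (suc m) n) ⟩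
      - (suc m ×′ 1# * (n ×′ 1#))      ≈⟨ -‿distribˡ-* _ _ ⟩
      - (suc m ×′ 1#) * (n ×′ 1#)      ∎
    *-homo -[1+ m ] -[1+ n ] = begin
      (suc m ℕ.* suc n) ×′ 1#              ≈⟨ ×1-homo-* (suc m) (suc n) ⟩
      suc m ×′ 1# * (suc n ×′ 1#)          ≈⟨ -‿involutive _ ⟨
      - - (suc m ×′ 1# * (suc n ×′ 1#))    ≈⟨ -‿cong (-‿distribˡ-* _ _) ⟩
      - (- (suc m ×′ 1#) * (suc n ×′ 1#))  ≈⟨ -‿distribʳ-* _ _ ⟩
      - (suc m ×′ 1#) * - (suc n ×′ 1#)    ∎

    neg-homo : ∀ i → ⟦ ℤ.- i ⟧ℤ ≈ - ⟦ i ⟧ℤ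
    neg-homo (+ zero)   = sym -0#≈0#
    neg-homo (+ suc n)  = refl
    neg-homo -[1+ n ]   = sym (-‿involutive _)

    morphism : ℤ.+-*-rawRing -Raw-AlmostCommutative⟶ fromCommutativeRing commutativeRing
    morphism = record
      { ⟦_⟧    = ⟦_⟧ℤ
      ; +-homo = +-homo
      ; *-homo = *-homo
      ; -‿homo = neg-homo
      ; 0-homo = refl
      ; 1-homo = refl
      }

    _≟_ : ∀ i j → Maybe (⟦ i ⟧ℤ ≈ ⟦ j ⟧ℤ)
    i ≟ j with i ℤ.≟ j
    ... | yes ≡.refl = just refl
    ... | no _       = nothing

    open RingSolver ℤ.+-*-rawRing (fromCommutativeRing commutativeRing) morphism _≟_ public
      using (solve; _:+_; _:*_; _:-_; :-_; _:=_; con; Polynomial)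

    :0 :1 :2 : ∀ {n} → Polynomial n
    :0 = con (+ 0)
    :1 = con (+ 1)
    :2 = con (+ 2)

  open Solver using (solve; _:+_; _:*_; _:-_; :-_; _:=_; :0; :1; :2)
  open Mult semiring using (×-homo-+; ×1-homo-*) renaming (_×_ to _·_)
  module ≤-Reasoning = PosetReasoning poset

  -- Ordered-field arithmetic, positive inverses, halving

  2# : Carrier
  2# = 1# + 1#

  0≤y-x : ∀ {x y} → x ≤ y → 0# ≤ y - x
  0≤y-x {x} {y} x≤y = begin
    0#       ≈⟨ -‿inverseˡ x ⟨
    - x + x  ≤⟨ +-monoʳ-≤ (- x) x≤y ⟩
    - x + y  ≈⟨ +-comm _ _ ⟩
    y - x    ∎
    where open ≤-Reasoning

  -- The difference of the two sides is exhibited as a nonnegative expression,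
  -- which turns most inequalities into ring identities.
  ≤-by : ∀ {x y z} → 0# ≤ z → y - x ≈ z → x ≤ y
  ≤-by {x} {y} {z} 0≤z y-x≈z = begin
    x            ≈⟨ +-identityʳ x ⟨
    x + 0#       ≤⟨ +-monoʳ-≤ x 0≤z ⟩
    x + z        ≈⟨ +-congˡ y-x≈z ⟨
    x + (y - x)  ≈⟨ solve 2 (λ x y → x :+ (y :- x) := y) refl x y ⟩
    y            ∎
    where open ≤-Reasoning

  infixl 6 _⊕_
  infixl 7 _⊗_

  _⊕_ : ∀ {x y} → 0# ≤ x → 0# ≤ y → 0# ≤ x + y
  _⊕_ {x} {y} 0≤x 0≤y = ≤-trans 0≤x (≤-respˡ (+-identityʳ x) (+-monoʳ-≤ x 0≤y))

  _⊗_ : ∀ {x y} → 0# ≤ x → 0# ≤ y → 0# ≤ x * y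
  _⊗_ = *-nonNeg

  neg-mono-≤ : ∀ {x y} → x ≤ y → - y ≤ - x
  neg-mono-≤ {x} {y} x≤y = ≤-by (0≤y-x x≤y) (solve 2 (λ x y → :- x :- :- y := y :- x) refl x y)

  +-mono-≤ : ∀ {w x y z} → w ≤ x → y ≤ z → w + y ≤ x + z
  +-mono-≤ {w} {x} {y} {z} w≤x y≤z = ≤-by (0≤y-x w≤x ⊕ 0≤y-x y≤z)
    (solve 4 (λ w x y z → (x :+ z) :- (w :+ y) := (x :- w) :+ (z :- y)) refl w x y z)

  *-monoˡ-≤ : ∀ {z x y} → 0# ≤ z → x ≤ y → z * x ≤ z * y
  *-monoˡ-≤ {z} {x} {y} 0≤z x≤y = ≤-by (0≤z ⊗ 0≤y-x x≤y)
    (solve 3 (λ x y z → z :* y :- z :* x := z :* (y :- x)) refl x y z)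

  *-monoʳ-≤ : ∀ {z x y} → 0# ≤ z → x ≤ y → x * z ≤ y * z
  *-monoʳ-≤ {z} {x} {y} 0≤z x≤y = ≤-by (0≤z ⊗ 0≤y-x x≤y)
    (solve 3 (λ x y z → y :* z :- x :* z := z :* (y :- x)) refl x y z)

  *-mono-≤ : ∀ {w x y z} → 0# ≤ w → 0# ≤ z → w ≤ x → y ≤ z → w * y ≤ x * z
  *-mono-≤ 0≤w 0≤z w≤x y≤z = ≤-trans (*-monoˡ-≤ 0≤w y≤z) (*-monoʳ-≤ 0≤z w≤x)

  0≤1 : 0# ≤ 1#
  0≤1 with total 0# 1#
  ... | inj₁ 0≤1 = 0≤1
  ... | inj₂ 1≤0 = ≤-respʳ (solve 0 ((:0 :- :1) :* (:0 :- :1) := :1) refl) (0≤y-x 1≤0 ⊗ 0≤y-x 1≤0)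

  <⇒≤ : ∀ {x y} → x < y → x ≤ y
  <⇒≤ = proj₁

  <⇒≱ : ∀ {x y} → x < y → ¬ (y ≤ x)
  <⇒≱ = ToStrict.<⇒≱ _≈_ _≤_ antisym

  ≰⇒> : ∀ {x y} → ¬ (x ≤ y) → y < x
  ≰⇒> = ToStrict.≰⇒> _≈_ _≤_ sym ≤-reflexive total

  <-≤-trans : ∀ {x y z} → x < y → y ≤ z → x < z
  <-≤-trans = ToStrict.<-≤-trans _≈_ _≤_ sym ≤-trans antisym ≤-respʳ

  ≤-<-trans : ∀ {x y z} → x ≤ y → y < z → x < z
  ≤-<-trans = ToStrict.≤-<-trans _≈_ _≤_ ≤-trans antisym ≤-respˡ

  0<1 : 0# < 1#
  0<1 = 0≤1 , 0≉1

  +-pos-nonNeg : ∀ {x y} → 0# < x → 0# ≤ y → 0# < x + y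
  +-pos-nonNeg {x} {y} 0<x 0≤y = <-≤-trans 0<x (≤-by 0≤y (solve 2 (λ x y → x :+ y :- x := y) refl x y))

  0<2 : 0# < 2#
  0<2 = +-pos-nonNeg 0<1 0≤1

  ⁻¹-pos : ∀ {x} → 0# < x → 0# < x ⁻¹
  ⁻¹-pos {x} (0≤x , 0≉x) = nonNeg , λ 0≈x⁻¹ → 0≉1 (begin
    0#        ≈⟨ zeroʳ x ⟨
    x * 0#    ≈⟨ *-congˡ 0≈x⁻¹ ⟩
    x * x ⁻¹  ≈⟨ xx⁻¹≈1 ⟩
    1#        ∎)
    where
    open import Relation.Binary.Reasoning.Setoid setoid
    xx⁻¹≈1 = *-inverseʳ {x} (0≉x ∘ sym)
    nonNeg : 0# ≤ x ⁻¹
    nonNeg with total 0# (x ⁻¹)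
    ... | inj₁ 0≤x⁻¹ = 0≤x⁻¹
    ... | inj₂ x⁻¹≤0 = contradiction (antisym 0≤1 (≤-by (0≤x ⊗ 0≤y-x x⁻¹≤0) (begin
      0# - 1#           ≈⟨ +-congˡ (-‿cong xx⁻¹≈1) ⟨
      0# - x * x ⁻¹     ≈⟨ solve 2 (λ x y → :0 :- x :* y := x :* (:0 :- y)) refl x (x ⁻¹) ⟩
      x * (0# - x ⁻¹)   ∎))) 0≉1

  pos-inverseʳ : ∀ {x} → 0# < x → x * x ⁻¹ ≈ 1#
  pos-inverseʳ (_ , 0≉x) = *-inverseʳ (0≉x ∘ sym)

  *-pos : ∀ {x y} → 0# < x → 0# < y → 0# < x * y
  *-pos {x} {y} 0<x 0<y = (<⇒≤ 0<x ⊗ <⇒≤ 0<y) , λ 0≈xy → proj₂ 0<y (begin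
    0#                ≈⟨ zeroʳ _ ⟨
    x ⁻¹ * 0#         ≈⟨ *-congˡ 0≈xy ⟩
    x ⁻¹ * (x * y)    ≈⟨ solve 3 (λ x y z → z :* (x :* y) := (x :* z) :* y) refl x y (x ⁻¹) ⟩
    (x * x ⁻¹) * y    ≈⟨ *-congʳ (pos-inverseʳ 0<x) ⟩
    1# * y            ≈⟨ *-identityˡ y ⟩
    y                 ∎)
    where open import Relation.Binary.Reasoning.Setoid setoid

  ½ : Carrier
  ½ = 2# ⁻¹

  0<½ : 0# < ½
  0<½ = ⁻¹-pos 0<2

  ½+½ : ∀ x → ½ * x + ½ * x ≈ x
  ½+½ x = begin
    ½ * x + ½ * x   ≈⟨ solve 2 (λ h x → h :* x :+ h :* x := (:2 :* h) :* x) refl ½ x ⟩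
    (2# * ½) * x    ≈⟨ *-congʳ (pos-inverseʳ 0<2) ⟩
    1# * x          ≈⟨ *-identityˡ x ⟩
    x               ∎
    where open import Relation.Binary.Reasoning.Setoid setoid

  ½-pos : ∀ {x} → 0# < x → 0# < ½ * x
  ½-pos = *-pos 0<½

  ½-< : ∀ {x} → 0# < x → ½ * x < x
  ½-< {x} 0<x = ≤-by (<⇒≤ (½-pos 0<x)) lemma ,
    λ h≈x → proj₂ (½-pos 0<x) (begin
      0#         ≈⟨ -‿inverseʳ x ⟨
      x - x      ≈⟨ +-congˡ (-‿cong h≈x) ⟨
      x - ½ * x  ≈⟨ lemma ⟩
      ½ * x      ∎)
    where
    open import Relation.Binary.Reasoning.Setoid setoid
    lemma : x - ½ * x ≈ ½ * x
    lemma = begin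
      x - ½ * x                   ≈⟨ +-congʳ (½+½ x) ⟨
      ½ * x + ½ * x - ½ * x       ≈⟨ solve 1 (λ h → h :+ h :- h := h) refl (½ * x) ⟩
      ½ * x                       ∎

  -- Otherwise half of the gap x - y is an admissible ε that leaves y + ε below x. Limits and
  -- Riemann sums are controlled only up to such an ε; this removes it.
  ≤-from-≤+ε : ∀ {x y} → (∀ ε → 0# < ε → x ≤ y + ε) → x ≤ y
  ≤-from-≤+ε {x} {y} h with em {x ≤ y}
  ... | yes x≤y = x≤y
  ... | no  x≰y = contradiction y+½ε<x (λ p → <⇒≱ p (h (½ * (x - y)) (½-pos 0<ε)))
    where
    y<x = ≰⇒> x≰y
    0<ε : 0# < x - y
    0<ε = 0≤y-x (<⇒≤ y<x) , λ 0≈ → x≰y (≤-by ≤-refl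
      (trans (solve 2 (λ x y → y :- x := :- (x :- y)) refl x y) (trans (-‿cong (sym 0≈)) (solve 0 (:- :0 := :0) refl))))
    y+½ε<x : y + ½ * (x - y) < x
    y+½ε<x = ≤-<-trans ≤-refl (≤-by (0≤y-x (<⇒≤ (½-< 0<ε))) eq , λ e → proj₂ (½-< 0<ε) (begin
        ½ * (x - y)              ≈⟨ solve 2 (λ y h → h := y :+ h :- y) refl y _ ⟩
        y + ½ * (x - y) - y      ≈⟨ +-congʳ e ⟩
        x - y                    ∎))
      where
      open import Relation.Binary.Reasoning.Setoid setoid
      eq : x - (y + ½ * (x - y)) ≈ (x - y) - ½ * (x - y)
      eq = solve 3 (λ x y h → x :- (y :+ h) := (x :- y) :- h) refl x y _

  -- Absolute value

  open Max totalOrder using (⊔-lub; x≤x⊔y; x≤y⊔x; ⊔-cong)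

  x≤∣x∣ : ∀ x → x ≤ ∣ x ∣
  x≤∣x∣ x = x≤x⊔y x (- x)

  -x≤∣x∣ : ∀ x → - x ≤ ∣ x ∣
  -x≤∣x∣ x = x≤y⊔x x (- x)

  ∣∣-≤ : ∀ {x e} → x ≤ e → - x ≤ e → ∣ x ∣ ≤ e
  ∣∣-≤ = ⊔-lub

  ∣∣-cong : ∀ {x y} → x ≈ y → ∣ x ∣ ≈ ∣ y ∣
  ∣∣-cong x≈y = ⊔-cong x≈y (-‿cong x≈y)

  ∣x∣≤e⇒x≤e : ∀ {x e} → ∣ x ∣ ≤ e → x ≤ e
  ∣x∣≤e⇒x≤e {x} = ≤-trans (x≤∣x∣ x)

  0≤∣x∣ : ∀ x → 0# ≤ ∣ x ∣
  0≤∣x∣ x with total 0# x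
  ... | inj₁ 0≤x = ≤-trans 0≤x (x≤∣x∣ x)
  ... | inj₂ x≤0 = ≤-trans (≤-respˡ (solve 0 (:- :0 := :0) refl) (neg-mono-≤ x≤0)) (-x≤∣x∣ x)

  nonNeg⇒∣x∣≈x : ∀ {x} → 0# ≤ x → ∣ x ∣ ≈ x
  nonNeg⇒∣x∣≈x {x} 0≤x = antisym (∣∣-≤ ≤-refl (≤-by (0≤x ⊕ 0≤x) (solve 1 (λ x → x :- :- x := x :+ x) refl x))) (x≤∣x∣ x)

  ∣-x∣≈∣x∣ : ∀ x → ∣ - x ∣ ≈ ∣ x ∣
  ∣-x∣≈∣x∣ x = antisym
    (∣∣-≤ (-x≤∣x∣ x) (≤-respˡ (solve 1 (λ x → x := :- :- x) refl x) (x≤∣x∣ x)))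
    (∣∣-≤ (≤-respˡ (solve 1 (λ x → :- :- x := x) refl x) (-x≤∣x∣ (- x))) (x≤∣x∣ (- x)))

  ∣x-y∣≈∣y-x∣ : ∀ x y → ∣ x - y ∣ ≈ ∣ y - x ∣
  ∣x-y∣≈∣y-x∣ x y = trans (∣∣-cong (solve 2 (λ x y → x :- y := :- (y :- x)) refl x y)) (∣-x∣≈∣x∣ (y - x))

  ∣x+y∣≤∣x∣+∣y∣ : ∀ x y → ∣ x + y ∣ ≤ ∣ x ∣ + ∣ y ∣
  ∣x+y∣≤∣x∣+∣y∣ x y = ∣∣-≤ (+-mono-≤ (x≤∣x∣ x) (x≤∣x∣ y))
    (≤-respˡ (solve 2 (λ x y → :- x :+ :- y := :- (x :+ y)) refl x y) (+-mono-≤ (-x≤∣x∣ x) (-x≤∣x∣ y)))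

  ∣∣-triangle : ∀ {x y z d e} → ∣ x - y ∣ ≤ d → ∣ y - z ∣ ≤ e → ∣ x - z ∣ ≤ d + e
  ∣∣-triangle {x} {y} {z} {d} {e} p q = begin
    ∣ x - z ∣                ≈⟨ ∣∣-cong (solve 3 (λ x y z → x :- z := (x :- y) :+ (y :- z)) refl x y z) ⟩
    ∣ (x - y) + (y - z) ∣    ≤⟨ ∣x+y∣≤∣x∣+∣y∣ _ _ ⟩
    ∣ x - y ∣ + ∣ y - z ∣    ≤⟨ +-mono-≤ p q ⟩
    d + e                    ∎
    where open ≤-Reasoning

  ∣x*y∣≈x*∣y∣ : ∀ {x} y → 0# ≤ x → ∣ x * y ∣ ≈ x * ∣ y ∣
  ∣x*y∣≈x*∣y∣ {x} y 0≤x with total 0# y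
  ... | inj₁ 0≤y = trans (nonNeg⇒∣x∣≈x (0≤x ⊗ 0≤y)) (*-congˡ (sym (nonNeg⇒∣x∣≈x 0≤y)))
  ... | inj₂ y≤0 = begin
    ∣ x * y ∣          ≈⟨ ∣-x∣≈∣x∣ _ ⟨
    ∣ - (x * y) ∣      ≈⟨ ∣∣-cong (solve 2 (λ x y → :- (x :* y) := x :* (:0 :- y)) refl x y) ⟩
    ∣ x * (0# - y) ∣   ≈⟨ nonNeg⇒∣x∣≈x (0≤x ⊗ 0≤y-x y≤0) ⟩
    x * (0# - y)       ≈⟨ *-congˡ (nonNeg⇒∣x∣≈x (0≤y-x y≤0)) ⟨
    x * ∣ 0# - y ∣     ≈⟨ *-congˡ (∣∣-cong (+-identityˡ (- y))) ⟩
    x * ∣ - y ∣        ≈⟨ *-congˡ (∣-x∣≈∣x∣ y) ⟩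
    x * ∣ y ∣          ∎
    where open import Relation.Binary.Reasoning.Setoid setoid

  ∣x*y∣≈∣x∣*∣y∣ : ∀ x y → ∣ x * y ∣ ≈ ∣ x ∣ * ∣ y ∣
  ∣x*y∣≈∣x∣*∣y∣ x y with total 0# x
  ... | inj₁ 0≤x = trans (∣x*y∣≈x*∣y∣ y 0≤x) (*-congʳ (sym (nonNeg⇒∣x∣≈x 0≤x)))
  ... | inj₂ x≤0 = begin
    ∣ x * y ∣            ≈⟨ ∣-x∣≈∣x∣ _ ⟨
    ∣ - (x * y) ∣        ≈⟨ ∣∣-cong (solve 2 (λ x y → :- (x :* y) := :- x :* y) refl x y) ⟩
    ∣ - x * y ∣          ≈⟨ ∣x*y∣≈x*∣y∣ y 0≤-x ⟩
    - x * ∣ y ∣          ≈⟨ *-congʳ (nonNeg⇒∣x∣≈x 0≤-x) ⟨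
    ∣ - x ∣ * ∣ y ∣      ≈⟨ *-congʳ (∣-x∣≈∣x∣ x) ⟩
    ∣ x ∣ * ∣ y ∣        ∎
    where
    open import Relation.Binary.Reasoning.Setoid setoid
    0≤-x : 0# ≤ - x
    0≤-x = ≤-respʳ (+-identityˡ (- x)) (0≤y-x x≤0)

  ∣x*y∣≤ : ∀ {x y d e} → ∣ x ∣ ≤ d → ∣ y ∣ ≤ e → ∣ x * y ∣ ≤ d * e
  ∣x*y∣≤ {x} {y} p q = ≤-respˡ (sym (∣x*y∣≈∣x∣*∣y∣ x y)) (*-mono-≤ (0≤∣x∣ x) (≤-trans (0≤∣x∣ y) q) p q)

  -- Natural numbers

  ι : ℕ → Carrier
  ι n = n · 1#

  0≤ι : ∀ n → 0# ≤ ι n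
  0≤ι zero    = ≤-refl
  0≤ι (suc n) = 0≤1 ⊕ 0≤ι n

  0<ι : ∀ n → 0# < ι (suc n)
  0<ι n = +-pos-nonNeg 0<1 (0≤ι n)

  ι-mono-≤ : ∀ {m n} → m ℕ.≤ n → ι m ≤ ι n
  ι-mono-≤ {n = n} ℕ.z≤n = 0≤ι n
  ι-mono-≤ (ℕ.s≤s m≤n)   = +-monoʳ-≤ 1# (ι-mono-≤ m≤n)

  -- If every ι n were below x, the numbers below some ι n would have a supremum s. Adding 1 does
  -- not leave this set, so s - 1 would be an upper bound as well.
  archimedean : ∀ x → ∃ λ n → x ≤ ι n
  archimedean x with em {∃ λ n → x ≤ ι n}
  ... | yes p = p
  ... | no ¬p = contradiction (proj₂ (sup P (0# , 0 , ≤-refl) (x , λ (n , y≤n) → ≤-trans y≤n (below n)))) absurd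
    where
    P : Carrier → Set
    P y = ∃ λ n → y ≤ ι n
    below : ∀ n → ι n ≤ x
    below n = <⇒≤ (≰⇒> λ x≤n → ¬p (n , x≤n))
    absurd : ∀ {s} → ¬ (IsUpperBound P s × (∀ {u} → IsUpperBound P u → s ≤ u))
    absurd {s} (upper , least) = <⇒≱ (0<1) (≤-by (0≤y-x s≤s-1)
      (solve 1 (λ s → :0 :- :1 := (s :- :1) :- s) refl s))
      where
      s≤s-1 : s ≤ s - 1#
      s≤s-1 = least λ {y} (n , y≤n) → ≤-by
        (0≤y-x (≤-trans (+-monoʳ-≤ 1# y≤n) (upper (suc n , ≤-refl))))
        (solve 2 (λ s y → (s :- :1) :- y := s :- (:1 :+ y)) refl s y)

  small-fraction : ∀ x {ε} → 0# < ε → ∃ λ n → x * ι (suc n) ⁻¹ ≤ ε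
  small-fraction x {ε} 0<ε with archimedean (x * ε ⁻¹)
  ... | n , xε⁻¹≤n = n , (begin
    x * N ⁻¹                ≈⟨ *-congʳ (trans (*-congˡ (pos-inverseʳ 0<ε)) (*-identityʳ x)) ⟨
    x * (ε * ε ⁻¹) * N ⁻¹   ≈⟨ solve 4 (λ x e d n → x :* (e :* d) :* n := (x :* d) :* (e :* n)) refl x ε (ε ⁻¹) (N ⁻¹) ⟩
    x * ε ⁻¹ * (ε * N ⁻¹)   ≤⟨ *-monoʳ-≤ (<⇒≤ (*-pos 0<ε (⁻¹-pos (0<ι n)))) (≤-trans xε⁻¹≤n (ι-mono-≤ (ℕ.n≤1+n n))) ⟩
    N * (ε * N ⁻¹)          ≈⟨ solve 3 (λ n e d → n :* (e :* d) := e :* (n :* d)) refl N ε (N ⁻¹) ⟩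
    ε * (N * N ⁻¹)          ≈⟨ *-congˡ (pos-inverseʳ (0<ι n)) ⟩
    ε * 1#                  ≈⟨ *-identityʳ ε ⟩
    ε                       ∎)
    where
    open ≤-Reasoning
    N = ι (suc n)

  open Analysis ℝ
  open Exp commutativeSemiring using (^-distrib-*; ^-congˡ)
  open Sum semiring using (sum-cong-≋; *-distribˡ-sum; ∑-distrib-+)

  -- Small positive quantities and finite sums

  min-pos : ∀ {x y} → 0# < x → 0# < y → ∃ λ z → 0# < z × z ≤ x × z ≤ y
  min-pos {x} {y} 0<x 0<y with total x y
  ... | inj₁ x≤y = x , 0<x , ≤-refl , x≤y
  ... | inj₂ y≤x = y , 0<y , y≤x , ≤-refl

  small-factor : ∀ {x ε} → 0# ≤ x → 0# < ε → ∃ λ δ → 0# < δ × δ * x ≤ ε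
  small-factor {x} {ε} 0≤x 0<ε = δ , 0<δ , (begin
    δ * x                   ≤⟨ *-monoˡ-≤ (<⇒≤ 0<δ) (≤-by 0≤1 (solve 1 (λ x → (:1 :+ x) :- x := :1) refl x)) ⟩
    ε * u ⁻¹ * u            ≈⟨ solve 3 (λ e d u → e :* d :* u := e :* (u :* d)) refl ε (u ⁻¹) u ⟩
    ε * (u * u ⁻¹)          ≈⟨ *-congˡ (pos-inverseʳ 0<u) ⟩
    ε * 1#                  ≈⟨ *-identityʳ ε ⟩
    ε                       ∎)
    where
    open ≤-Reasoning
    -- `x` may be zero, so the division is by `1# + x`, which is positive in any case and exceeds
    -- `x`.
    u   = 1# + x
    0<u = +-pos-nonNeg 0<1 0≤x
    δ   = ε * u ⁻¹
    0<δ = *-pos 0<ε (⁻¹-pos 0<u)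

  sum-mono-≤ : ∀ {n} {s t : Fin n → Carrier} → (∀ k → s k ≤ t k) → sum s ≤ sum t
  sum-mono-≤ {zero}  s≤t = ≤-refl
  sum-mono-≤ {suc n} s≤t = +-mono-≤ (s≤t zero) (sum-mono-≤ (s≤t ∘ suc))

  ∣sum∣≤sum : ∀ {n} {s t : Fin n → Carrier} → (∀ k → ∣ s k ∣ ≤ t k) → ∣ sum s ∣ ≤ sum t
  ∣sum∣≤sum {zero}  _     = ≤-reflexive (nonNeg⇒∣x∣≈x ≤-refl)
  ∣sum∣≤sum {suc n} ∣s∣≤t = ≤-trans (∣x+y∣≤∣x∣+∣y∣ _ _) (+-mono-≤ (∣s∣≤t zero) (∣sum∣≤sum (∣s∣≤t ∘ suc)))

  sum-telescope : ∀ n (x : Fin (suc n) → Carrier) →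
                  sum (λ k → x (suc k) - x (inject₁ k)) ≈ x (fromℕ n) - x zero
  sum-telescope zero    x = sym (-‿inverseʳ _)
  sum-telescope (suc n) x = trans (+-congˡ (sum-telescope n (x ∘ suc)))
    (solve 3 (λ a b c → (b :- a) :+ (c :- b) := c :- a) refl (x zero) (x (suc zero)) (x (suc (fromℕ n))))

  sum-minus : ∀ n (s t : Fin n → Carrier) → sum (λ k → s k - t k) ≈ sum s - sum t
  sum-minus zero    s t = sym (-‿inverseʳ 0#)
  sum-minus (suc n) s t = trans (+-congˡ (sum-minus n (s ∘ suc) (t ∘ suc)))
    (solve 4 (λ a b c d → (a :- b) :+ (c :- d) := (a :+ c) :- (b :+ d)) refl _ _ _ _)

  sum-toℕ-last : ∀ n (t : ℕ → Carrier) → sum {suc n} (t ∘ toℕ) ≈ sum {n} (t ∘ toℕ) + t n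
  sum-toℕ-last zero    t = +-comm _ _
  sum-toℕ-last (suc n) t = trans (+-congˡ (sum-toℕ-last n (t ∘ suc))) (sym (+-assoc _ _ _))

  -- Power series

  eventually-bounded⇒bounded : ∀ N (t : ℕ → Carrier) M → (∀ k → N ℕ.≤ k → ∣ t k ∣ ≤ M) → ∃ λ M → ∀ k → ∣ t k ∣ ≤ M
  eventually-bounded⇒bounded zero    t M h = M , λ k → h k ℕ.z≤n
  eventually-bounded⇒bounded (suc N) t M h
    with M′ , h′ ← eventually-bounded⇒bounded N (t ∘ suc) M (λ k N≤k → h (suc k) (ℕ.s≤s N≤k))
    = ∣ t 0 ∣ + M′ , λ where
        zero    → ≤-by (≤-trans (0≤∣x∣ _) (h′ 0)) (solve 2 (λ a b → a :+ b :- a := b) refl _ _)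
        (suc k) → ≤-trans (h′ k) (≤-by (0≤∣x∣ (t 0)) (solve 2 (λ a b → a :+ b :- b := a) refl _ _))

  -- A term is the difference of two consecutive partial sums, each eventually within 1 of the
  -- limit; hence the bound 2 on all but finitely many terms.
  convergent⇒bounded-terms : ∀ (t : ℕ → Carrier) {l} → (λ n → sum {n} (t ∘ toℕ)) ⟶ l → ∃ λ M → ∀ k → ∣ t k ∣ ≤ M
  convergent⇒bounded-terms t {l} conv with N , close ← conv 1# 0<1 = eventually-bounded⇒bounded N t 2# λ k N≤k → begin
    ∣ t k ∣            ≈⟨ ∣∣-cong (trans (solve 2 (λ s t → t := (s :+ t) :- s) refl (S k) (t k)) (+-congʳ (sym (sum-toℕ-last k t)))) ⟩
    ∣ S (suc k) - S k ∣ ≤⟨ ∣∣-triangle (<⇒≤ (close (suc k) (ℕ.m≤n⇒m≤1+n N≤k))) (≤-respˡ (∣x-y∣≈∣y-x∣ _ _) (<⇒≤ (close k N≤k))) ⟩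
    2#                 ∎
    where
    open ≤-Reasoning
    S : ℕ → Carrier
    S n = sum {n} (t ∘ toℕ)

  module PowerSeries {M z : Carrier} (∣z∣≤½ : ∣ z ∣ ≤ ½) where
    open ≤-Reasoning

    series : (ℕ → Carrier) → ℕ → Carrier
    series t n = sum {n} (λ k → t (toℕ k) * z ^ toℕ k)

    series-suc : ∀ t n → series t (suc n) ≈ t 0 + z * series (t ∘ suc) n
    series-suc t n = +-cong (*-identityʳ _) (trans
      (sum-cong-≋ {n} (λ k → solve 3 (λ t z p → t :* (z :* p) := z :* (t :* p)) refl (t (suc (toℕ k))) z (z ^ toℕ k)))
      (sym (*-distribˡ-sum z (λ (k : Fin n) → t (suc (toℕ k)) * z ^ toℕ k))))

    -- In Horner form the bound reproduces itself: M + ½ (M + M) is M + M again. No geometric series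
    -- has to be summed.
    series-bound : ∀ t → (∀ k → ∣ t k ∣ ≤ M) → ∀ n → ∣ series t n ∣ ≤ M + M
    series-bound t h zero    = ≤-trans (≤-reflexive (nonNeg⇒∣x∣≈x ≤-refl)) (0≤M ⊕ 0≤M)
      where
      0≤M = ≤-trans (0≤∣x∣ _) (h 0)
    series-bound t h (suc n) = begin
      ∣ series t (suc n) ∣                     ≈⟨ ∣∣-cong (series-suc t n) ⟩
      ∣ t 0 + z * series (t ∘ suc) n ∣         ≤⟨ ∣x+y∣≤∣x∣+∣y∣ _ _ ⟩
      ∣ t 0 ∣ + ∣ z * series (t ∘ suc) n ∣     ≤⟨ +-mono-≤ (h 0) (∣x*y∣≤ ∣z∣≤½ (series-bound (t ∘ suc) (h ∘ suc) n)) ⟩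
      M + ½ * (M + M)                          ≈⟨ +-congˡ (trans (distribˡ _ _ _) (½+½ M)) ⟩
      M + M                                    ∎

    series-tail-bound : ∀ t → (∀ k → ∣ t k ∣ ≤ M) → ∀ n → ∣ series t (suc n) - t 0 ∣ ≤ ∣ z ∣ * (M + M)
    series-tail-bound t h n = begin
      ∣ series t (suc n) - t 0 ∣    ≈⟨ ∣∣-cong (trans (+-congʳ (series-suc t n)) (solve 2 (λ a b → a :+ b :- a := b) refl _ _)) ⟩
      ∣ z * series (t ∘ suc) n ∣    ≤⟨ ∣x*y∣≤ ≤-refl (series-bound (t ∘ suc) (h ∘ suc) n) ⟩
      ∣ z ∣ * (M + M)               ∎

  ½≤1 : ½ ≤ 1#
  ½≤1 = ≤-respˡ (*-identityʳ ½) (<⇒≤ (½-< 0<1))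

  -- In the application s 0 is an empty partial sum and lacks the constant term, so the hypothesis
  -- starts at `suc n`.
  limit-bound : ∀ {s l a e} → s ⟶ l → (∀ n → ∣ s (suc n) - a ∣ ≤ e) → ∣ l - a ∣ ≤ e
  limit-bound {s} {l} {a} {e} s⟶l h = ≤-from-≤+ε λ ε 0<ε → let N , close = s⟶l ε 0<ε in
    ≤-respʳ (+-comm ε e) (∣∣-triangle (≤-respˡ (∣x-y∣≈∣y-x∣ _ _) (<⇒≤ (close (suc N) (ℕ.n≤1+n N)))) (h N))

  -- Convergence is known at points of [0,1] only, so bounding the coefficients calls for a point of
  -- [0,1] other than c. A step h ≤ ½ away from the nearer end stays inside.
  nearby-point : ∀ (c : [0,1]) {ρ} → 0# < ρ → ∃ λ (x : [0,1]) →
                 0# < ∣ proj₁ x - proj₁ c ∣ × ∣ proj₁ x - proj₁ c ∣ < ρ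
  nearby-point (c , 0≤c , c≤1) {ρ} 0<ρ
    with h , 0<h , h≤½ , h≤½ρ ← min-pos 0<½ (½-pos 0<ρ)
    with total c ½
  ... | inj₁ c≤½ = (c + h , 0≤c ⊕ <⇒≤ 0<h , c+h≤1) , <-≤-trans 0<h (≤-reflexive (sym eq)) ,
                   ≤-<-trans (≤-reflexive eq) (≤-<-trans h≤½ρ (½-< 0<ρ))
    where
    c+h≤1 : c + h ≤ 1#
    c+h≤1 = ≤-respʳ (trans (+-cong (sym (*-identityʳ ½)) (sym (*-identityʳ ½))) (½+½ 1#)) (+-mono-≤ c≤½ h≤½)
    eq : ∣ (c + h) - c ∣ ≈ h
    eq = trans (∣∣-cong (solve 2 (λ c h → c :+ h :- c := h) refl c h)) (nonNeg⇒∣x∣≈x (<⇒≤ 0<h))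
  ... | inj₂ ½≤c = (c - h , 0≤y-x (≤-trans h≤½ ½≤c) , c-h≤1) , <-≤-trans 0<h (≤-reflexive (sym eq)) ,
                   ≤-<-trans (≤-reflexive eq) (≤-<-trans h≤½ρ (½-< 0<ρ))
    where
    c-h≤1 : c - h ≤ 1#
    c-h≤1 = ≤-by (0≤y-x c≤1 ⊕ <⇒≤ 0<h) (solve 2 (λ c h → :1 :- (c :- h) := (:1 :- c) :+ h) refl c h)
    eq : ∣ (c - h) - c ∣ ≈ h
    eq = trans (∣∣-cong (solve 2 (λ c h → c :- h :- c := :- h) refl c h)) (trans (∣-x∣≈∣x∣ h) (nonNeg⇒∣x∣≈x (<⇒≤ 0<h)))

  -- Continuity at every point, in the form of small oscillation: two points near c are compared
  -- with each other, without passing through the value at c.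
  LocallyClose : UnitFunction → Set
  LocallyClose f = ∀ (c : [0,1]) ε → 0# < ε → ∃ λ η → 0# < η ×
    ∀ (s t : [0,1]) → ∣ proj₁ s - proj₁ c ∣ ≤ η → ∣ proj₁ t - proj₁ c ∣ ≤ η → ∣ Func.to f s - Func.to f t ∣ ≤ ε

  module Expansion (c d : Carrier) (0<∣d∣ : 0# < ∣ d ∣) (a : ℕ → Carrier)
                   (M : Carrier) (term≤M : ∀ k → ∣ a k * d ^ k ∣ ≤ M) where

    d≉0 : ¬ (d ≈ 0#)
    d≉0 d≈0 = proj₂ 0<∣d∣ (sym (trans (∣∣-cong d≈0) (nonNeg⇒∣x∣≈x ≤-refl)))

    0≤M : 0# ≤ M
    0≤M = ≤-trans (0≤∣x∣ _) (term≤M 0)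

    -- Writing x - c as d z with |z| ≤ θ turns the coefficients into a k d^k, which M bounds;
    -- convergence at c + d will supply M. The constant term is `a 0 * 1#` because `d ^ 0` reduces
    -- to `1#`.
    limit-close : ∀ {θ x l} → θ ≤ ½ → ∣ x - c ∣ ≤ θ * ∣ d ∣ →
                  (λ n → sum {n} (λ k → a (toℕ k) * (x - c) ^ toℕ k)) ⟶ l →
                  ∣ l - a 0 * 1# ∣ ≤ θ * (M + M)
    limit-close {θ} {x} θ≤½ ∣y∣≤ expansion = limit-bound expansion λ n → begin
      ∣ sum {suc n} (λ k → a (toℕ k) * y ^ toℕ k) - a 0 * 1# ∣
        ≈⟨ ∣∣-cong (+-congʳ (sum-cong-≋ {suc n} λ k → rescale (toℕ k))) ⟩
      ∣ series (λ k → a k * d ^ k) (suc n) - a 0 * 1# ∣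
        ≤⟨ series-tail-bound (λ k → a k * d ^ k) term≤M n ⟩
      ∣ z ∣ * (M + M)
        ≤⟨ *-monoʳ-≤ (0≤M ⊕ 0≤M) ∣z∣≤θ ⟩
      θ * (M + M) ∎
      where
      open ≤-Reasoning
      y = x - c
      z = y * d ⁻¹

      y≈dz : y ≈ d * z
      y≈dz = trans (sym (*-identityʳ y)) (trans (*-congˡ (sym (*-inverseʳ d≉0)))
        (solve 3 (λ y d e → y :* (d :* e) := d :* (y :* e)) refl y d (d ⁻¹)))

      ∣z∣≤θ : ∣ z ∣ ≤ θ
      ∣z∣≤θ = begin
        ∣ y * d ⁻¹ ∣              ≤⟨ ∣x*y∣≤ ∣y∣≤ ≤-refl ⟩
        θ * ∣ d ∣ * ∣ d ⁻¹ ∣       ≈⟨ *-assoc _ _ _ ⟩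
        θ * (∣ d ∣ * ∣ d ⁻¹ ∣)     ≈⟨ *-congˡ (∣x*y∣≈∣x∣*∣y∣ _ _) ⟨
        θ * ∣ d * d ⁻¹ ∣          ≈⟨ *-congˡ (trans (∣∣-cong (*-inverseʳ d≉0)) (nonNeg⇒∣x∣≈x 0≤1)) ⟩
        θ * 1#                    ≈⟨ *-identityʳ θ ⟩
        θ                         ∎

      open PowerSeries {M} {z} (≤-trans ∣z∣≤θ θ≤½)

      rescale : ∀ k → a k * y ^ k ≈ a k * d ^ k * z ^ k
      rescale k = trans (*-congˡ (trans (^-congˡ k y≈dz) (^-distrib-* d z k))) (sym (*-assoc _ _ _))

  analytic⇒locallyClose : ∀ f → RealAnalytic f → LocallyClose f
  analytic⇒locallyClose f analytic c ε 0<ε =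
    let ρ , 0<ρ , a , expansion = analytic c
        x₀ , 0<∣d∣ , ∣d∣<ρ = nearby-point c 0<ρ
        d = proj₁ x₀ - proj₁ c
        M , term≤M = convergent⇒bounded-terms (λ k → a k * d ^ k) (expansion x₀ ∣d∣<ρ)
        open Expansion (proj₁ c) d 0<∣d∣ a M term≤M
        -- Two demands on θ: at most ½ for the series bound, and θ (M + M) at most half of ε, since
        -- s and t are each compared with the constant term.
        θ₁ , 0<θ₁ , θ₁2M≤½ε = small-factor (0≤M ⊕ 0≤M) (½-pos 0<ε)
        θ , 0<θ , θ≤½ , θ≤θ₁ = min-pos 0<½ 0<θ₁
        θ∣d∣≤∣d∣ = ≤-respʳ (*-identityˡ ∣ d ∣) (*-monoʳ-≤ (0≤∣x∣ d) (≤-trans θ≤½ ½≤1))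
        close : ∀ x → ∣ proj₁ x - proj₁ c ∣ ≤ θ * ∣ d ∣ → ∣ Func.to f x - a 0 * 1# ∣ ≤ ½ * ε
        close x ∣y∣≤ = ≤-trans
          (limit-close θ≤½ ∣y∣≤ (expansion x (≤-<-trans (≤-trans ∣y∣≤ θ∣d∣≤∣d∣) ∣d∣<ρ)))
          (≤-trans (*-monoʳ-≤ (0≤M ⊕ 0≤M) θ≤θ₁) θ₁2M≤½ε)
    in θ * ∣ d ∣ , *-pos 0<θ 0<∣d∣ ,
       λ s t ∣s-c∣≤ ∣t-c∣≤ → ≤-respʳ (½+½ ε)
         (∣∣-triangle (close s ∣s-c∣≤) (≤-respˡ (∣x-y∣≈∣y-x∣ _ _) (close t ∣t-c∣≤)))

  -- From local to global closeness

  -- The bound with K (s − t)² is what a second moment estimate can use.  The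
  -- supremum of the u such that it holds on [0,u] for some K cannot be below 1,
  -- since enlarging K takes it past any such point.
  module QuadraticModulus (f : UnitFunction) {ε} (0<ε : 0# < ε) where
    open Func f using () renaming (to to f[_]; cong to f-cong)

    Bound : Carrier → [0,1] → [0,1] → Set
    Bound K s t = ∣ f[ s ] - f[ t ] ∣ ≤ ε + K * ((proj₁ s - proj₁ t) * (proj₁ s - proj₁ t))

    BoundedBelow : Carrier → Set
    BoundedBelow u = ∃ λ K → 0# ≤ K × (∀ s t → proj₁ s ≤ u → proj₁ t ≤ u → Bound K s t)

    x²≥0 : ∀ x → 0# ≤ x * x
    x²≥0 x with total 0# x
    ... | inj₁ 0≤x = 0≤x ⊗ 0≤x
    ... | inj₂ x≤0 = ≤-respʳ (solve 1 (λ x → (:0 :- x) :* (:0 :- x) := x :* x) refl x) (0≤y-x x≤0 ⊗ 0≤y-x x≤0)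

    close⇒Bound : ∀ {K} → 0# ≤ K → ∀ s t → ∣ f[ s ] - f[ t ] ∣ ≤ ε → Bound K s t
    close⇒Bound {K} 0≤K s t close = ≤-trans close (≤-by (0≤K ⊗ x²≥0 (proj₁ s - proj₁ t))
      (solve 2 (λ a b → a :+ b :- a := b) refl _ _))

    module Extend {σ η u : Carrier} (0<η : 0# < η)
      (local : ∀ s t → ∣ proj₁ s - σ ∣ ≤ η + η → ∣ proj₁ t - σ ∣ ≤ η + η → ∣ f[ s ] - f[ t ] ∣ ≤ ε)
      (0≤u : 0# ≤ u) (u≤1 : u ≤ 1#) (σ-η≤u : σ - η ≤ u) (u≤σ : u ≤ σ) where

      0≤η = <⇒≤ 0<η

      within : ∀ {x} → σ - (η + η) ≤ x → x ≤ σ + η → ∣ x - σ ∣ ≤ η + η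
      within {x} p q = ∣∣-≤
        (≤-by (0≤y-x q ⊕ 0≤η) (solve 3 (λ x s h → h :+ h :- (x :- s) := (s :+ h :- x) :+ h) refl x σ η))
        (≤-by (0≤y-x p) (solve 3 (λ x s h → h :+ h :- (:- (x :- s)) := x :- (s :- (h :+ h))) refl x σ η))

      σ-2η≤u : σ - (η + η) ≤ u
      σ-2η≤u = ≤-trans (≤-by 0≤η (solve 2 (λ s h → s :- h :- (s :- (h :+ h)) := h) refl σ η)) σ-η≤u

      u≤σ+η : u ≤ σ + η
      u≤σ+η = ≤-trans u≤σ (≤-by 0≤η (solve 2 (λ s h → s :+ h :- s := h) refl σ η))

      L : Carrier
      L = ε * (η ⁻¹ * η ⁻¹)

      0≤L : 0# ≤ L
      0≤L = <⇒≤ 0<ε ⊗ (<⇒≤ (⁻¹-pos 0<η) ⊗ <⇒≤ (⁻¹-pos 0<η))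

      ε≤Lw² : ∀ {w} → η ≤ w → ε ≤ L * (w * w)
      ε≤Lw² {w} η≤w = begin
        ε                          ≈⟨ solve 1 (λ e → e := e :* (:1 :* :1)) refl ε ⟩
        ε * (1# * 1#)              ≈⟨ *-congˡ (*-cong (pos-inverseʳ 0<η) (pos-inverseʳ 0<η)) ⟨
        ε * (η * η ⁻¹ * (η * η ⁻¹)) ≈⟨ solve 3 (λ e h i → e :* (h :* i :* (h :* i)) := e :* (i :* i) :* (h :* h)) refl ε η (η ⁻¹) ⟩
        L * (η * η)                ≤⟨ *-monoˡ-≤ 0≤L (*-mono-≤ 0≤η (≤-trans 0≤η η≤w) η≤w η≤w) ⟩
        L * (w * w)                ∎
        where open ≤-Reasoning

      -- Three cases for s ≤ t ≤ σ + η. If t is below u, the old K works. If t is above u and s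
      -- above σ - 2η, both points lie in the local neighbourhood. Otherwise they are at least η
      -- apart, and passing through u costs one extra ε, which L (s - t)² absorbs.
      extend : BoundedBelow u → BoundedBelow (σ + η)
      extend (K , 0≤K , bound) = K + L , 0≤K ⊕ 0≤L , bound′
        where
        open ≤-Reasoning
        ordered : ∀ s t → proj₁ s ≤ proj₁ t → proj₁ t ≤ σ + η → Bound (K + L) s t
        ordered s@(s′ , _) t@(t′ , _) s≤t t≤σ+η with total t′ u | total (σ - (η + η)) s′
        ... | inj₁ t≤u | _ = ≤-trans (bound s t (≤-trans s≤t t≤u) t≤u)
          (≤-by (0≤L ⊗ x²≥0 (s′ - t′)) (solve 4 (λ e k l w → e :+ (k :+ l) :* w :- (e :+ k :* w) := l :* w) refl ε K L _))
        ... | inj₂ u≤t | inj₁ σ-2η≤s = close⇒Bound (0≤K ⊕ 0≤L) s t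
          (local s t (within σ-2η≤s (≤-trans s≤t t≤σ+η)) (within (≤-trans σ-2η≤s s≤t) t≤σ+η))
        ... | inj₂ u≤t | inj₂ s≤σ-2η = begin
          ∣ f[ s ] - f[ t ] ∣
            ≤⟨ ∣∣-triangle (bound s (u , 0≤u , u≤1) s≤u ≤-refl)
               (local (u , 0≤u , u≤1) t (within σ-2η≤u u≤σ+η) (within (≤-trans σ-2η≤u u≤t) t≤σ+η)) ⟩
          ε + K * ((s′ - u) * (s′ - u)) + ε
            ≤⟨ +-mono-≤ (+-monoʳ-≤ ε (*-monoˡ-≤ 0≤K (≤-by (0≤y-x u≤t ⊗ (0≤y-x s≤t ⊕ 0≤y-x s≤u))
                 (solve 3 (λ s t u → (s :- t) :* (s :- t) :- (s :- u) :* (s :- u) := (t :- u) :* (t :- s :+ (u :- s))) refl s′ t′ u))))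
               (ε≤Lw² η≤t-s) ⟩
          ε + K * ((s′ - t′) * (s′ - t′)) + L * ((t′ - s′) * (t′ - s′))
            ≈⟨ solve 5 (λ e k l s t → e :+ k :* ((s :- t) :* (s :- t)) :+ l :* ((t :- s) :* (t :- s))
                                      := e :+ (k :+ l) :* ((s :- t) :* (s :- t))) refl ε K L s′ t′ ⟩
          ε + (K + L) * ((s′ - t′) * (s′ - t′)) ∎
          where
          s≤u = ≤-trans s≤σ-2η σ-2η≤u
          η≤t-s : η ≤ t′ - s′
          η≤t-s = ≤-by (0≤y-x u≤t ⊕ 0≤y-x σ-η≤u ⊕ 0≤y-x s≤σ-2η)
            (solve 5 (λ s t u o h → (t :- s) :- h := (t :- u) :+ (u :- (o :- h)) :+ (o :- (h :+ h) :- s)) refl s′ t′ u σ η)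

        bound′ : ∀ s t → proj₁ s ≤ σ + η → proj₁ t ≤ σ + η → Bound (K + L) s t
        bound′ s t s≤ t≤ with total (proj₁ s) (proj₁ t)
        ... | inj₁ s≤t = ordered s t s≤t t≤
        ... | inj₂ t≤s = ≤-respˡ (∣x-y∣≈∣y-x∣ _ _) (≤-respʳ
          (solve 4 (λ e k s t → e :+ k :* ((t :- s) :* (t :- s)) := e :+ k :* ((s :- t) :* (s :- t))) refl ε (K + L) (proj₁ s) (proj₁ t))
          (ordered t s t≤s s≤))

    P : Carrier → Set
    P u = 0# ≤ u × u ≤ 1# × BoundedBelow u

    P0 : P 0#
    P0 = ≤-refl , 0≤1 , 0# , ≤-refl , λ s t s≤0 t≤0 → close⇒Bound ≤-refl s t (≤-trans
      (≤-reflexive (trans (∣∣-cong (trans (+-congʳ (f-cong {s} {t} (trans (≈0 s s≤0) (sym (≈0 t t≤0))))) (-‿inverseʳ _)))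
        (nonNeg⇒∣x∣≈x ≤-refl)))
      (<⇒≤ 0<ε))
      where
      ≈0 : ∀ (s : [0,1]) → proj₁ s ≤ 0# → proj₁ s ≈ 0#
      ≈0 (_ , 0≤s , _) s≤0 = antisym s≤0 0≤s

    not-below : ∀ {σ η} → 0# < η → ¬ (σ ≤ σ - η)
    not-below {σ} {η} 0<η p = <⇒≱ 0<η (≤-by (0≤y-x p) (solve 2 (λ s h → :0 :- h := s :- h :- s) refl σ η))

    not-above : ∀ {σ η} → 0# < η → ¬ (σ + η ≤ σ)
    not-above {σ} {η} 0<η p = <⇒≱ 0<η (≤-by (0≤y-x p) (solve 2 (λ s h → :0 :- h := s :- (s :+ h)) refl σ η))

    quadratic-modulus : LocallyClose f → ∃ λ K → 0# ≤ K × (∀ s t → Bound K s t)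
    quadratic-modulus locallyClose =
      let σ , upper , least = sup P (0# , P0) (1# , λ (_ , u≤1 , _) → u≤1)
          σ≤1 = least λ (_ , u≤1 , _) → u≤1
          η′ , 0<η′ , local = locallyClose (σ , upper P0 , σ≤1) ε 0<ε
          -- Halved because `Extend` uses the local estimate out to distance η + η.
          η = ½ * η′
          0<η = ½-pos 0<η′
          2η≤η′ = ≤-reflexive (½+½ η′)
          u , (0≤u , u≤1 , below) , σ-η≤u = near-sup {η = η} upper least 0<η
          K , 0≤K , bound = Extend.extend 0<η (λ s t p q → local s t (≤-trans p 2η≤η′) (≤-trans q 2η≤η′))
                              0≤u u≤1 σ-η≤u (upper (0≤u , u≤1 , below)) below
      in K , 0≤K , λ s t → bound s t (≤-trans (proj₂ (proj₂ s)) (reaches-1 0<η (upper P0) upper (K , 0≤K , bound)))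
                                     (≤-trans (proj₂ (proj₂ t)) (reaches-1 0<η (upper P0) upper (K , 0≤K , bound)))
      where
      near-sup : ∀ {σ η} → IsUpperBound P σ → (∀ {v} → IsUpperBound P v → σ ≤ v) → 0# < η →
                 ∃ λ u → P u × σ - η ≤ u
      near-sup {σ} {η} upper least 0<η with em {∃ λ u → P u × σ - η ≤ u}
      ... | yes found = found
      ... | no ¬found = contradiction (least λ {u} Pu → [ (λ p → contradiction (u , Pu , p) ¬found) , (λ p → p) ]′ (total (σ - η) u))
                                      (not-below 0<η)

      -- If σ + η were at most 1 it would belong to `P`, beyond its upper bound σ. Hence the
      -- extended estimate already covers all of [0,1].
      reaches-1 : ∀ {σ η} → 0# < η → 0# ≤ σ → IsUpperBound P σ → BoundedBelow (σ + η) → 1# ≤ σ + η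
      reaches-1 {σ} {η} 0<η 0≤σ upper below with total 1# (σ + η)
      ... | inj₁ p = p
      ... | inj₂ p = contradiction (upper (0≤σ ⊕ <⇒≤ 0<η , p , below)) (not-above 0<η)

  -- Bernstein polynomials

  -- The de Casteljau recursion with control values g. It avoids binomial coefficients; in
  -- probabilistic terms it conditions a binomial variable on one trial.
  bernstein : ∀ n → (Fin (suc n) → Carrier) → Carrier → Carrier
  bernstein zero    g x = g zero
  bernstein (suc n) g x = (1# - x) * bernstein n (g ∘ inject₁) x + x * bernstein n (g ∘ suc) x

  -- (h n x − c)² + h² n x (1 − x) is the second moment about c of h times a
  -- binomial (n, x) random variable.
  bernstein-bound : ∀ {x y h ε K} → 0# ≤ x → x ≤ 1# → ∀ n c (g : Fin (suc n) → Carrier) →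
    (∀ k → ∣ g k - y ∣ ≤ ε + K * ((h * ι (toℕ k) - c) * (h * ι (toℕ k) - c))) →
    ∣ bernstein n g x - y ∣ ≤ ε + K * ((h * ι n * x - c) * (h * ι n * x - c) + h * h * ι n * (x * (1# - x)))
  bernstein-bound {x} {y} {h} {ε} {K} 0≤x x≤1 zero c g close = ≤-respʳ
    (solve 5 (λ x h e k c → e :+ k :* ((h :* :0 :- c) :* (h :* :0 :- c))
        := e :+ k :* ((h :* :0 :* x :- c) :* (h :* :0 :* x :- c) :+ h :* h :* :0 :* (x :* (:1 :- x)))) refl x h ε K c)
    (close zero)
  bernstein-bound {x} {y} {h} {ε} {K} 0≤x x≤1 (suc n) c g close = begin
    ∣ (1# - x) * p + x * q - y ∣
      ≈⟨ ∣∣-cong (solve 4 (λ x y p q → (:1 :- x) :* p :+ x :* q :- y := (:1 :- x) :* (p :- y) :+ x :* (q :- y)) refl x y p q) ⟩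
    ∣ (1# - x) * (p - y) + x * (q - y) ∣
      ≤⟨ ∣x+y∣≤∣x∣+∣y∣ _ _ ⟩
    ∣ (1# - x) * (p - y) ∣ + ∣ x * (q - y) ∣
      ≈⟨ +-cong (∣x*y∣≈x*∣y∣ _ (0≤y-x x≤1)) (∣x*y∣≈x*∣y∣ _ 0≤x) ⟩
    (1# - x) * ∣ p - y ∣ + x * ∣ q - y ∣
      ≤⟨ +-mono-≤
           (*-monoˡ-≤ (0≤y-x x≤1) (bernstein-bound 0≤x x≤1 n c (g ∘ inject₁) close-inject₁))
           -- A success raises the index by one, and h (k + 1) - c equals h k - (c - h). This is why
           -- the centre c has to vary in the induction, while the mesh h stays fixed as n
           -- decreases.
           (*-monoˡ-≤ 0≤x (bernstein-bound 0≤x x≤1 n (c - h) (g ∘ suc) close-suc)) ⟩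
    (1# - x) * (ε + K * ((h * ι n * x - c) * (h * ι n * x - c) + h * h * ι n * (x * (1# - x))))
      + x * (ε + K * ((h * ι n * x - (c - h)) * (h * ι n * x - (c - h)) + h * h * ι n * (x * (1# - x))))
      ≈⟨ solve 6 (λ x h e k c m →
           (:1 :- x) :* (e :+ k :* ((h :* m :* x :- c) :* (h :* m :* x :- c) :+ h :* h :* m :* (x :* (:1 :- x))))
             :+ x :* (e :+ k :* ((h :* m :* x :- (c :- h)) :* (h :* m :* x :- (c :- h)) :+ h :* h :* m :* (x :* (:1 :- x))))
           := e :+ k :* ((h :* (:1 :+ m) :* x :- c) :* (h :* (:1 :+ m) :* x :- c) :+ h :* h :* (:1 :+ m) :* (x :* (:1 :- x))))
           refl x h ε K c (ι n) ⟩
    ε + K * ((h * ι (suc n) * x - c) * (h * ι (suc n) * x - c) + h * h * ι (suc n) * (x * (1# - x))) ∎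
    where
    open ≤-Reasoning
    p = bernstein n (g ∘ inject₁) x
    q = bernstein n (g ∘ suc) x

    close-inject₁ : ∀ k → ∣ g (inject₁ k) - y ∣ ≤ ε + K * ((h * ι (toℕ k) - c) * (h * ι (toℕ k) - c))
    close-inject₁ k = ≡.subst (λ i → ∣ g (inject₁ k) - y ∣ ≤ ε + K * ((h * ι i - c) * (h * ι i - c)))
      (toℕ-inject₁ k) (close (inject₁ k))

    close-suc : ∀ k → ∣ g (suc k) - y ∣ ≤ ε + K * ((h * ι (toℕ k) - (c - h)) * (h * ι (toℕ k) - (c - h)))
    close-suc k = ≤-respʳ
      (solve 5 (λ h e k c m → e :+ k :* ((h :* (:1 :+ m) :- c) :* (h :* (:1 :+ m) :- c))
         := e :+ k :* ((h :* m :- (c :- h)) :* (h :* m :- (c :- h)))) refl h ε K c (ι (toℕ k)))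
      (close (suc k))

  module Approximation (f : UnitFunction) where
    open Func f using () renaming (to to f[_])

    fraction : ∀ n → Fin (suc (suc n)) → [0,1]
    fraction n k = ι (suc n) ⁻¹ * ι (toℕ k) , 0≤h ⊗ 0≤ι (toℕ k) ,
      ≤-trans (*-monoˡ-≤ 0≤h (ι-mono-≤ (toℕ≤pred[n] k))) (≤-reflexive (trans (*-comm _ _) (pos-inverseʳ (0<ι n))))
      where
      0≤h = <⇒≤ (⁻¹-pos (0<ι n))

    -- With h = 1/N and centre x the squared bias (h N x - x)² vanishes, and the variance term is K
    -- x (1 - x) / N ≤ K / N. The modulus and the variance take half of ε each.
    bernstein-approximation : LocallyClose f → ∀ ε → 0# < ε →
      ∃₂ λ n g → ∀ x → ∣ f[ x ] - bernstein n g (proj₁ x) ∣ ≤ ε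
    bernstein-approximation locallyClose ε 0<ε =
      let K , 0≤K , bound = QuadraticModulus.quadratic-modulus f (½-pos 0<ε) locallyClose
          n , K/n≤½ε = small-fraction K (½-pos 0<ε)
      in suc n , (λ k → f[ fraction n k ]) , λ x → ≤-respˡ (∣x-y∣≈∣y-x∣ _ _) (≤-trans
           (bernstein-bound (proj₁ (proj₂ x)) (proj₂ (proj₂ x)) (suc n) (proj₁ x) _ (λ k → bound (fraction n k) x))
           (variance n 0≤K x K/n≤½ε))
      where
      open ≤-Reasoning
      variance : ∀ n {K} → 0# ≤ K → ∀ (x : [0,1]) → K * ι (suc n) ⁻¹ ≤ ½ * ε → let N = ι (suc n) ; x = proj₁ x in
        ½ * ε + K * ((N ⁻¹ * N * x - x) * (N ⁻¹ * N * x - x) + N ⁻¹ * N ⁻¹ * N * (x * (1# - x))) ≤ ε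
      variance n {K} 0≤K (x , 0≤x , x≤1) K/n≤½ε = begin
        ½ * ε + K * ((h * N * x - x) * (h * N * x - x) + h * h * N * (x * (1# - x)))
          ≈⟨ +-congˡ (*-congˡ (+-cong (*-cong hNx-x≈0 hNx-x≈0) (*-congʳ (trans (*-assoc h h N) (*-congˡ hN≈1))))) ⟩
        ½ * ε + K * (0# * 0# + h * 1# * (x * (1# - x)))
          ≤⟨ +-monoʳ-≤ (½ * ε) (*-monoˡ-≤ 0≤K (≤-by (0≤h ⊗ (0≤y-x x≤1 ⊕ 0≤x ⊗ 0≤x))
               (solve 2 (λ x h → h :- (:0 :* :0 :+ h :* :1 :* (x :* (:1 :- x))) := h :* (:1 :- x :+ x :* x)) refl x h))) ⟩
        ½ * ε + K * h
          ≤⟨ +-monoʳ-≤ (½ * ε) K/n≤½ε ⟩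
        ½ * ε + ½ * ε
          ≈⟨ ½+½ ε ⟩
        ε ∎
        where
        N = ι (suc n)
        h = N ⁻¹
        0≤h = <⇒≤ (⁻¹-pos (0<ι n))
        hN≈1 : h * N ≈ 1#
        hN≈1 = trans (*-comm h N) (pos-inverseʳ (0<ι n))
        hNx-x≈0 : h * N * x - x ≈ 0#
        hNx-x≈0 = trans (+-congʳ (trans (*-congʳ hN≈1) (*-identityˡ x))) (-‿inverseʳ x)

  -- Primitives

  -- Differentiation in a uniform form: the tag t may lie anywhere between x and y, and the error is
  -- quadratic in the width. Over a partition of mesh δ the errors add up to at most K δ times the
  -- total length, with no mean value theorem.
  IsPrimitive : (Carrier → Carrier) → (Carrier → Carrier) → Set
  IsPrimitive F p = ∃ λ K → 0# ≤ K × (∀ {x t y} → 0# ≤ x → x ≤ t → t ≤ y → y ≤ 1# →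
    ∣ p t * (y - x) - (F y - F x) ∣ ≤ K * ((y - x) * (y - x)))

  primitive-cong : ∀ {F G p q} → (∀ x → F x ≈ G x) → (∀ x → p x ≈ q x) → IsPrimitive F p → IsPrimitive G q
  primitive-cong F≈G p≈q (K , 0≤K , bound) = K , 0≤K , λ {x} {t} {y} 0≤x x≤t t≤y y≤1 →
    ≤-respˡ (∣∣-cong (+-cong (*-congʳ (p≈q t)) (-‿cong (+-cong (F≈G y) (-‿cong (F≈G x)))))) (bound 0≤x x≤t t≤y y≤1)

  primitive-+ : ∀ {F G p q} → IsPrimitive F p → IsPrimitive G q →
                IsPrimitive (λ x → F x + G x) (λ x → p x + q x)
  primitive-+ {F} {G} {p} {q} (K , 0≤K , bound) (L , 0≤L , bound′) = K + L , 0≤K ⊕ 0≤L , λ {x} {t} {y} 0≤x x≤t t≤y y≤1 → begin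
    ∣ (p t + q t) * (y - x) - ((F y + G y) - (F x + G x)) ∣
      ≈⟨ ∣∣-cong (solve 7 (λ p q w a b c d → (p :+ q) :* w :- ((a :+ b) :- (c :+ d))
           := (p :* w :- (a :- c)) :+ (q :* w :- (b :- d))) refl (p t) (q t) (y - x) (F y) (G y) (F x) (G x)) ⟩
    ∣ (p t * (y - x) - (F y - F x)) + (q t * (y - x) - (G y - G x)) ∣
      ≤⟨ ≤-trans (∣x+y∣≤∣x∣+∣y∣ _ _) (+-mono-≤ (bound 0≤x x≤t t≤y y≤1) (bound′ 0≤x x≤t t≤y y≤1)) ⟩
    K * ((y - x) * (y - x)) + L * ((y - x) * (y - x))
      ≈⟨ distribʳ _ _ _ ⟨
    (K + L) * ((y - x) * (y - x)) ∎
    where open ≤-Reasoning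

  primitive-* : ∀ c {F p} → IsPrimitive F p → IsPrimitive (λ x → c * F x) (λ x → c * p x)
  primitive-* c {F} {p} (K , 0≤K , bound) = ∣ c ∣ * K , 0≤∣x∣ c ⊗ 0≤K , λ {x} {t} {y} 0≤x x≤t t≤y y≤1 → begin
    ∣ c * p t * (y - x) - (c * F y - c * F x) ∣
      ≈⟨ ∣∣-cong (solve 5 (λ c p w a b → c :* p :* w :- (c :* a :- c :* b) := c :* (p :* w :- (a :- b)))
           refl c (p t) (y - x) (F y) (F x)) ⟩
    ∣ c * (p t * (y - x) - (F y - F x)) ∣
      ≤⟨ ∣x*y∣≤ ≤-refl (bound 0≤x x≤t t≤y y≤1) ⟩
    ∣ c ∣ * (K * ((y - x) * (y - x)))
      ≈⟨ *-assoc _ _ _ ⟨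
    ∣ c ∣ * K * ((y - x) * (y - x)) ∎
    where open ≤-Reasoning

  -- The derivative of t^k as the product rule yields it from the recursion of `_^_`. It suits
  -- induction on k better than the closed form, which would subtract 1 from the exponent.
  slope : ℕ → Carrier → Carrier
  slope zero    t = 0#
  slope (suc k) t = t ^ k + t * slope k t

  slope-suc : ∀ k t → slope (suc k) t ≈ ι (suc k) * t ^ k
  slope-suc zero    t = solve 1 (λ t → :1 :+ t :* :0 := (:1 :+ :0) :* :1) refl t
  slope-suc (suc k) t = trans (+-congˡ (*-congˡ (slope-suc k t)))
    (solve 3 (λ t p m → t :* p :+ t :* (m :* p) := (:1 :+ m) :* (t :* p)) refl t (t ^ k) (ι (suc k)))

  ∣x∣≤1 : ∀ {x} → 0# ≤ x → x ≤ 1# → ∣ x ∣ ≤ 1#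
  ∣x∣≤1 0≤x x≤1 = ≤-respˡ (sym (nonNeg⇒∣x∣≈x 0≤x)) x≤1

  ∣x^k∣≤1 : ∀ {x} → 0# ≤ x → x ≤ 1# → ∀ k → ∣ x ^ k ∣ ≤ 1#
  ∣x^k∣≤1 0≤x x≤1 zero    = ∣x∣≤1 0≤1 ≤-refl
  ∣x^k∣≤1 0≤x x≤1 (suc k) = ≤-respʳ (*-identityʳ 1#) (∣x*y∣≤ (∣x∣≤1 0≤x x≤1) (∣x^k∣≤1 0≤x x≤1 k))

  ∣slope∣≤ι : ∀ {t} → 0# ≤ t → t ≤ 1# → ∀ k → ∣ slope k t ∣ ≤ ι k
  ∣slope∣≤ι 0≤t t≤1 zero    = ≤-reflexive (nonNeg⇒∣x∣≈x ≤-refl)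
  ∣slope∣≤ι 0≤t t≤1 (suc k) = ≤-trans (∣x+y∣≤∣x∣+∣y∣ _ _) (+-mono-≤ (∣x^k∣≤1 0≤t t≤1 k)
    (≤-respʳ (*-identityˡ _) (∣x*y∣≤ (∣x∣≤1 0≤t t≤1) (∣slope∣≤ι 0≤t t≤1 k))))

  ^-Lipschitz : ∀ {x t} → 0# ≤ x → x ≤ t → t ≤ 1# → ∀ k → ∣ t ^ k - x ^ k ∣ ≤ ι k * (t - x)
  ^-Lipschitz {x} {t} 0≤x x≤t t≤1 zero    = ≤-reflexive (trans (∣∣-cong (-‿inverseʳ 1#))
    (trans (nonNeg⇒∣x∣≈x ≤-refl) (sym (zeroˡ _))))
  ^-Lipschitz {x} {t} 0≤x x≤t t≤1 (suc k) = begin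
    ∣ t * t ^ k - x * x ^ k ∣
      ≈⟨ ∣∣-cong (solve 4 (λ x t p q → t :* q :- x :* p := (t :- x) :* p :+ t :* (q :- p)) refl x t (x ^ k) (t ^ k)) ⟩
    ∣ (t - x) * x ^ k + t * (t ^ k - x ^ k) ∣
      ≤⟨ ∣x+y∣≤∣x∣+∣y∣ _ _ ⟩
    ∣ (t - x) * x ^ k ∣ + ∣ t * (t ^ k - x ^ k) ∣
      ≤⟨ +-mono-≤ (∣x*y∣≤ (≤-reflexive (nonNeg⇒∣x∣≈x (0≤y-x x≤t))) (∣x^k∣≤1 0≤x (≤-trans x≤t t≤1) k))
                  (∣x*y∣≤ (∣x∣≤1 (≤-trans 0≤x x≤t) t≤1) (^-Lipschitz 0≤x x≤t t≤1 k)) ⟩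
    (t - x) * 1# + 1# * (ι k * (t - x))
      ≈⟨ solve 2 (λ w m → w :* :1 :+ :1 :* (m :* w) := (:1 :+ m) :* w) refl (t - x) (ι k) ⟩
    ι (suc k) * (t - x) ∎
    where open ≤-Reasoning

  ^-primitive-slope : ∀ k → IsPrimitive (_^ k) (slope k)
  ^-primitive-slope zero    = 0# , ≤-refl , λ {x} {t} {y} _ _ _ _ → ≤-reflexive
    (trans (∣∣-cong (solve 1 (λ w → :0 :* w :- (:1 :- :1) := :0) refl (y - x)))
      (trans (nonNeg⇒∣x∣≈x ≤-refl) (sym (zeroˡ _))))
  ^-primitive-slope (suc k) with K , 0≤K , bound ← ^-primitive-slope k =
    K + ι k + ι k , 0≤K ⊕ 0≤ι k ⊕ 0≤ι k , λ {x} {t} {y} 0≤x x≤t t≤y y≤1 →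
      let 0≤t = ≤-trans 0≤x x≤t
          t≤1 = ≤-trans t≤y y≤1
          0≤y = ≤-trans 0≤t t≤y
          0≤w = 0≤y-x (≤-trans x≤t t≤y)
          ∣w∣≤w = ≤-reflexive (nonNeg⇒∣x∣≈x 0≤w)
          w = y - x
          D = slope k t
      in begin
    ∣ (t ^ k + t * D) * w - (y * y ^ k - x * x ^ k) ∣
      -- Product rule with a tag: y times the error for exponent k, a correction for having t
      -- instead of y in front of D, and one for t^k against x^k. The bounds on `slope` and on the
      -- Lipschitz constant make both corrections quadratic, whence the two copies of ι k.
      ≈⟨ ∣∣-cong (solve 7 (λ x t y a b c d → (b :+ t :* d) :* (y :- x) :- (y :* c :- x :* a)
           := y :* (d :* (y :- x) :- (c :- a)) :+ (:- ((y :- t) :* (d :* (y :- x))) :+ (b :- a) :* (y :- x)))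
           refl x t y (x ^ k) (t ^ k) (y ^ k) D) ⟩
    ∣ y * (D * w - (y ^ k - x ^ k)) + (- ((y - t) * (D * w)) + (t ^ k - x ^ k) * w) ∣
      ≤⟨ ≤-trans (∣x+y∣≤∣x∣+∣y∣ _ _) (+-monoʳ-≤ _ (∣x+y∣≤∣x∣+∣y∣ _ _)) ⟩
    ∣ y * (D * w - (y ^ k - x ^ k)) ∣ + (∣ - ((y - t) * (D * w)) ∣ + ∣ (t ^ k - x ^ k) * w ∣)
      ≤⟨ +-mono-≤ (∣x*y∣≤ (∣x∣≤1 0≤y y≤1) (bound 0≤x x≤t t≤y y≤1)) (+-mono-≤
           (≤-respˡ (sym (∣-x∣≈∣x∣ _)) (∣x*y∣≤ (≤-respˡ (sym (nonNeg⇒∣x∣≈x (0≤y-x t≤y)))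
             (≤-by (0≤y-x x≤t) (solve 3 (λ x t y → y :- x :- (y :- t) := t :- x) refl x t y)))
             (∣x*y∣≤ (∣slope∣≤ι 0≤t t≤1 k) ∣w∣≤w)))
           (∣x*y∣≤ (≤-trans (^-Lipschitz 0≤x x≤t t≤1 k) (*-monoˡ-≤ (0≤ι k)
             (≤-by (0≤y-x t≤y) (solve 3 (λ x t y → y :- x :- (t :- x) := y :- t) refl x t y)))) ∣w∣≤w)) ⟩
    1# * (K * (w * w)) + (w * (ι k * w) + ι k * w * w)
      ≈⟨ solve 3 (λ w k m → :1 :* (k :* (w :* w)) :+ (w :* (m :* w) :+ m :* w :* w) := (k :+ m :+ m) :* (w :* w)) refl w K (ι k) ⟩
    (K + ι k + ι k) * (w * w) ∎
    where open ≤-Reasoning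

  -- An antiderivative of x^k times `bernstein n g`. The factor x^k lets the recursion close:
  -- multiplying out 1 - x and x keeps k or raises it by one, until only a monomial is left.
  antiderivative : ∀ n → (Fin (suc n) → Carrier) → ℕ → Carrier → Carrier
  antiderivative zero    g k x = g zero * ι (suc k) ⁻¹ * x ^ suc k
  antiderivative (suc n) g k x =
    antiderivative n (g ∘ inject₁) k x + (antiderivative n (g ∘ suc) (suc k) x + - 1# * antiderivative n (g ∘ inject₁) (suc k) x)

  antiderivative-isPrimitive : ∀ n g k → IsPrimitive (antiderivative n g k) (λ x → x ^ k * bernstein n g x)
  antiderivative-isPrimitive zero    g k = primitive-cong (λ _ → refl)
    (λ x → trans (*-congˡ (slope-suc k x)) (trans
      (solve 4 (λ g i m p → g :* i :* (m :* p) := p :* g :* (m :* i)) refl (g zero) (ι (suc k) ⁻¹) (ι (suc k)) (x ^ k))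
      (trans (*-congˡ (pos-inverseʳ (0<ι k))) (*-identityʳ _))))
    (primitive-* (g zero * ι (suc k) ⁻¹) (^-primitive-slope (suc k)))
  antiderivative-isPrimitive (suc n) g k = primitive-cong (λ _ → refl)
    (λ x → solve 4 (λ x p a b → p :* a :+ (x :* p :* b :+ :- :1 :* (x :* p :* a)) := p :* ((:1 :- x) :* a :+ x :* b))
             refl x (x ^ k) (bernstein n (g ∘ inject₁) x) (bernstein n (g ∘ suc) x))
    (primitive-+ (antiderivative-isPrimitive n (g ∘ inject₁) k)
      (primitive-+ (antiderivative-isPrimitive n (g ∘ suc) (suc k))
        (primitive-* (- 1#) (antiderivative-isPrimitive n (g ∘ inject₁) (suc k)))))

  antiderivative-resp : ∀ n g k {x y} → x ≈ y → antiderivative n g k x ≈ antiderivative n g k y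
  antiderivative-resp zero    g k x≈y = *-congˡ (^-congˡ (suc k) x≈y)
  antiderivative-resp (suc n) g k x≈y = +-cong (antiderivative-resp n (g ∘ inject₁) k x≈y)
    (+-cong (antiderivative-resp n (g ∘ suc) (suc k) x≈y) (*-congˡ (antiderivative-resp n (g ∘ inject₁) (suc k) x≈y)))

  -- Riemann sums

  chain-first-≤ : ∀ n (x : Fin (suc n) → Carrier) → (∀ k → x (inject₁ k) ≤ x (suc k)) → ∀ k → x zero ≤ x k
  chain-first-≤ _       x mono zero    = ≤-refl
  chain-first-≤ (suc n) x mono (suc k) = ≤-trans (mono zero) (chain-first-≤ n (x ∘ suc) (mono ∘ suc) k)

  chain-≤-last : ∀ n (x : Fin (suc n) → Carrier) → (∀ k → x (inject₁ k) ≤ x (suc k)) → ∀ k → x k ≤ x (fromℕ n)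
  chain-≤-last zero    x mono zero    = ≤-refl
  chain-≤-last (suc n) x mono zero    = ≤-trans (mono zero) (chain-≤-last n (x ∘ suc) (mono ∘ suc) zero)
  chain-≤-last (suc n) x mono (suc k) = chain-≤-last n (x ∘ suc) (mono ∘ suc) k

  module Integral (f : UnitFunction) {a b : Carrier} (0≤a : 0# ≤ a) (a≤b : a ≤ b) (b≤1 : b ≤ 1#) where
    open Func f using () renaming (to to f[_])
    open TaggedPartition

    Finer : Carrier → TaggedPartition a b → Set
    Finer δ P = ∀ k → width P k < δ

    0≤b-a : 0# ≤ b - a
    0≤b-a = 0≤y-x a≤b

    b-a≤1 : b - a ≤ 1#
    b-a≤1 = ≤-by (0≤y-x b≤1 ⊕ 0≤a) (solve 2 (λ a b → :1 :- (b :- a) := (:1 :- b) :+ a) refl a b)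

    *[b-a]≤ : ∀ {x} → 0# ≤ x → x * (b - a) ≤ x
    *[b-a]≤ {x} 0≤x = ≤-respʳ (*-identityʳ x) (*-monoˡ-≤ 0≤x b-a≤1)

    module Uniform (n : ℕ) where
      h = ι (suc n) ⁻¹
      0≤h = <⇒≤ (⁻¹-pos (0<ι n))

      at : ℕ → Carrier
      at i = a + (b - a) * h * ι i

      step : ∀ i → at (suc i) - at i ≈ (b - a) * h
      step i = solve 3 (λ a w m → (a :+ w :* (:1 :+ m)) :- (a :+ w :* m) := w) refl a ((b - a) * h) (ι i)

      at-inject₁ : ∀ {m} (k : Fin m) → at (toℕ (inject₁ k)) ≈ at (toℕ k)
      at-inject₁ k = reflexive (≡.cong at (toℕ-inject₁ k))

      at-last : at (suc n) ≈ b
      at-last = trans (+-congˡ (trans (*-assoc _ _ _) (*-congˡ (trans (*-comm _ _) (pos-inverseʳ (0<ι n))))))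
        (solve 2 (λ a b → a :+ (b :- a) :* :1 := b) refl a b)

      at-mono : ∀ {i j} → i ℕ.≤ j → at i ≤ at j
      at-mono i≤j = +-monoʳ-≤ a (*-monoˡ-≤ (0≤b-a ⊗ 0≤h) (ι-mono-≤ i≤j))

      P : TaggedPartition a b
      P = record
        { size  = suc n
        ; point = at ∘ toℕ
        ; tag   = λ k → at (toℕ k) , 0≤a ⊕ 0≤b-a ⊗ 0≤h ⊗ 0≤ι (toℕ k) ,
                    ≤-trans (at-mono (ℕ.<⇒≤ (toℕ<n k))) (≤-trans (≤-reflexive at-last) b≤1)
        ; first = trans (+-congˡ (zeroʳ _)) (+-identityʳ a)
        ; last  = trans (reflexive (≡.cong at (toℕ-fromℕ (suc n)))) at-last
        ; left  = λ k → ≤-reflexive (at-inject₁ k)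
        ; right = λ k → at-mono (ℕ.n≤1+n (toℕ k))
        }

      width≈ : ∀ k → width P k ≈ (b - a) * h
      width≈ k = trans (+-congˡ (-‿cong (at-inject₁ k))) (step (toℕ k))

    -- Without partitions of every fineness, statements about all fine partitions could be vacuous
    -- and would not determine a value.
    fine-partition : ∀ {δ} → 0# < δ → ∃ (Finer δ)
    fine-partition 0<δ = let n , w≤½δ = small-fraction (b - a) (½-pos 0<δ) in
      Uniform.P n , λ k → ≤-<-trans (≤-trans (≤-reflexive (Uniform.width≈ n k)) w≤½δ) (½-< 0<δ)

    module _ (P : TaggedPartition a b) where

      point-mono : ∀ k → point P (inject₁ k) ≤ point P (suc k)
      point-mono k = ≤-trans (left P k) (right P k)

      0≤point : ∀ k → 0# ≤ point P k
      0≤point k = ≤-trans 0≤a (≤-respˡ (first P) (chain-first-≤ (size P) (point P) point-mono k))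

      point≤1 : ∀ k → point P k ≤ 1#
      point≤1 k = ≤-trans (≤-respʳ (last P) (chain-≤-last (size P) (point P) point-mono k)) b≤1

      riemannSum-bound : ∀ {F e} → (∀ {x y} → x ≈ y → F x ≈ F y) →
        (∀ k → ∣ f[ tag P k ] * width P k - (F (point P (suc k)) - F (point P (inject₁ k))) ∣ ≤ e * width P k) →
        ∣ riemannSum f P - (F b - F a) ∣ ≤ e * (b - a)
      riemannSum-bound {F} {e} F-resp bound = begin
        ∣ riemannSum f P - (F b - F a) ∣
          ≈⟨ ∣∣-cong (trans (+-congˡ (-‿cong telescope)) (sym (sum-minus (size P) _ _))) ⟩
        ∣ sum (λ k → f[ tag P k ] * width P k - (F (point P (suc k)) - F (point P (inject₁ k)))) ∣
          ≤⟨ ∣sum∣≤sum bound ⟩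
        sum (λ k → e * width P k)
          ≈⟨ *-distribˡ-sum e (width P) ⟨
        e * sum (width P)
          ≈⟨ *-congˡ (trans (sum-telescope (size P) (point P)) (+-cong (last P) (-‿cong (first P)))) ⟩
        e * (b - a) ∎
        where
        open ≤-Reasoning
        telescope : F b - F a ≈ sum (λ k → F (point P (suc k)) - F (point P (inject₁ k)))
        telescope = sym (trans (sum-telescope (size P) (F ∘ point P)) (+-cong (F-resp (last P)) (-‿cong (F-resp (first P)))))

    -- The weakening of `HasIntegral` that a single polynomial approximation can deliver: a value
    -- known up to e per unit length. The factor b - a keeps the total error over all subintervals
    -- of [0,1] at e.
    NearIntegral : Carrier → Carrier → Set
    NearIntegral e v = ∀ ε → 0# < ε → ∃ λ δ → 0# < δ ×
      (∀ P → Finer δ P → ∣ riemannSum f P - v ∣ ≤ e * (b - a) + ε)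

    primitive-nearIntegral : ∀ {F p e} → (∀ {x y} → x ≈ y → F x ≈ F y) → IsPrimitive F p →
      (∀ x → ∣ f[ x ] - p (proj₁ x) ∣ ≤ e) → NearIntegral e (F b - F a)
    primitive-nearIntegral {F} {p} {e} F-resp (K , 0≤K , bound) close ε 0<ε
      with δ , 0<δ , δK≤ε ← small-factor 0≤K 0<ε = δ , 0<δ , λ P finer → begin
        ∣ riemannSum f P - (F b - F a) ∣
          ≤⟨ riemannSum-bound P {F} {e + δ * K} F-resp (term P finer) ⟩
        (e + δ * K) * (b - a)
          ≈⟨ distribʳ _ _ _ ⟩
        e * (b - a) + δ * K * (b - a)
          ≤⟨ +-monoʳ-≤ _ (≤-trans (*[b-a]≤ (<⇒≤ 0<δ ⊗ 0≤K)) δK≤ε) ⟩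
        e * (b - a) + ε ∎
      where
      open ≤-Reasoning
      term : ∀ P → Finer δ P → ∀ k →
        ∣ f[ tag P k ] * width P k - (F (point P (suc k)) - F (point P (inject₁ k))) ∣ ≤ (e + δ * K) * width P k
      term P finer k = begin
        ∣ f[ tag P k ] * w - (F y - F x) ∣
          ≈⟨ ∣∣-cong (solve 4 (λ f p w d → f :* w :- d := w :* (f :- p) :+ (p :* w :- d)) refl f[ tag P k ] (p t) w (F y - F x)) ⟩
        ∣ w * (f[ tag P k ] - p t) + (p t * w - (F y - F x)) ∣
          ≤⟨ ∣x+y∣≤∣x∣+∣y∣ _ _ ⟩
        ∣ w * (f[ tag P k ] - p t) ∣ + ∣ p t * w - (F y - F x) ∣
          ≤⟨ +-mono-≤ (∣x*y∣≤ (≤-reflexive (nonNeg⇒∣x∣≈x 0≤w)) (close (tag P k)))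
               (bound (0≤point P (inject₁ k)) (left P k) (right P k) (point≤1 P (suc k))) ⟩
        w * e + K * (w * w)
          ≤⟨ +-monoʳ-≤ _ (*-monoˡ-≤ 0≤K (*-monoʳ-≤ 0≤w (<⇒≤ (finer k)))) ⟩
        w * e + K * (δ * w)
          ≈⟨ solve 4 (λ w e k d → w :* e :+ k :* (d :* w) := (e :+ d :* k) :* w) refl w e K δ ⟩
        (e + δ * K) * w ∎
        where
        x = point P (inject₁ k)
        y = point P (suc k)
        t = proj₁ (tag P k)
        w = width P k
        0≤w = 0≤y-x (point-mono P k)

    nearIntegral-unique : ∀ {e v e′ v′} → NearIntegral e v → NearIntegral e′ v′ → ∣ v - v′ ∣ ≤ (e + e′) * (b - a)
    nearIntegral-unique {e} {v} {e′} {v′} near near′ = ≤-from-≤+ε λ ε 0<ε →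
      let δ₁ , 0<δ₁ , close₁ = near (½ * ε) (½-pos 0<ε)
          δ₂ , 0<δ₂ , close₂ = near′ (½ * ε) (½-pos 0<ε)
          δ , 0<δ , δ≤δ₁ , δ≤δ₂ = min-pos 0<δ₁ 0<δ₂
          P , finer = fine-partition 0<δ
      in begin
        ∣ v - v′ ∣
          ≤⟨ ∣∣-triangle (≤-respˡ (∣x-y∣≈∣y-x∣ _ _) (close₁ P λ k → <-≤-trans (finer k) δ≤δ₁))
                         (close₂ P λ k → <-≤-trans (finer k) δ≤δ₂) ⟩
        e * (b - a) + ½ * ε + (e′ * (b - a) + ½ * ε)
          ≈⟨ solve 4 (λ e e′ w h → e :* w :+ h :+ (e′ :* w :+ h) := (e :+ e′) :* w :+ (h :+ h)) refl e e′ (b - a) (½ * ε) ⟩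
        (e + e′) * (b - a) + (½ * ε + ½ * ε)
          ≈⟨ +-congˡ (½+½ ε) ⟩
        (e + e′) * (b - a) + ε ∎
      where open ≤-Reasoning

    hasIntegral⇒nearIntegral : ∀ {v} → HasIntegral f a b v → NearIntegral 0# v
    hasIntegral⇒nearIntegral has ε 0<ε with δ , 0<δ , close ← has ε 0<ε = δ , 0<δ ,
      λ P finer → ≤-trans (<⇒≤ (close P finer)) (≤-reflexive (solve 2 (λ e w → e := :0 :* w :+ e) refl ε (b - a)))

    -- The intervals of radius e (b - a) around the near integrals meet pairwise by
    -- `nearIntegral-unique`, so the supremum of their left ends lies in every one of them.
    nearIntegrals⇒integrable : (∀ e → 0# < e → ∃ (NearIntegral e)) → ∃ (HasIntegral f a b)
    nearIntegrals⇒integrable near =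
      let v , upper , least = sup Lower nonempty (upper-bound (proj₂ (near 1# 0<1)))
      in v , λ ε 0<ε →
        -- An eighth of ε: the Riemann sum is within q + q of w, and w within q of v, rounded up to
        -- q + q. Together this is ½ ε, strictly below ε.
        let q = ½ * (½ * (½ * ε))
            0<q = ½-pos (½-pos (½-pos 0<ε))
            w , w-near = near q 0<q
            δ , 0<δ , close = w-near q 0<q
        in δ , 0<δ , λ P finer → ≤-<-trans
          (∣∣-triangle (≤-trans (close P finer) (+-mono-≤ (*[b-a]≤ (<⇒≤ 0<q)) ≤-refl))
                       (≤-trans (∣w-v∣≤ upper least w-near) (≤-trans (*[b-a]≤ (<⇒≤ 0<q)) (q≤q+q (<⇒≤ 0<q)))))
          (≤-<-trans (≤-reflexive (trans (+-cong (½+½ _) (½+½ _)) (½+½ _))) (½-< 0<ε))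
      where
      Lower : Carrier → Set
      Lower w = ∃₂ λ e v → NearIntegral e v × w ≤ v - e * (b - a)

      nonempty : ∃ Lower
      nonempty = let v , v-near = near 1# 0<1 in _ , 1# , v , v-near , ≤-refl

      near⇒upperBound : ∀ {e v} → NearIntegral e v → IsUpperBound Lower (v + e * (b - a))
      near⇒upperBound {e} {v} v-near {w} (e′ , v′ , v′-near , w≤) = ≤-by
        (0≤y-x w≤ ⊕ 0≤y-x (∣x∣≤e⇒x≤e (nearIntegral-unique v′-near v-near)))
        (solve 6 (λ v e v′ e′ l w → v :+ e :* l :- w := (v′ :- e′ :* l :- w) :+ ((e′ :+ e) :* l :- (v′ :- v))) refl v e v′ e′ (b - a) w)

      upper-bound : ∀ {e v} → NearIntegral e v → ∃ (IsUpperBound Lower)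
      upper-bound v-near = _ , near⇒upperBound v-near

      q≤q+q : ∀ {q} → 0# ≤ q → q ≤ q + q
      q≤q+q {q} 0≤q = ≤-by 0≤q (solve 1 (λ q → q :+ q :- q := q) refl q)

      ∣w-v∣≤ : ∀ {v w e} → IsUpperBound Lower v → (∀ {u} → IsUpperBound Lower u → v ≤ u) →
               NearIntegral e w → ∣ w - v ∣ ≤ e * (b - a)
      ∣w-v∣≤ {v} {w} {e} upper least w-near = ∣∣-≤
        (≤-by (0≤y-x (upper (e , w , w-near , ≤-refl)))
          (solve 3 (λ v w d → d :- (w :- v) := v :- (w :- d)) refl v w (e * (b - a))))
        (≤-by (0≤y-x (least (near⇒upperBound w-near)))
          (solve 3 (λ v w d → d :- (:- (w :- v)) := (w :+ d) :- v) refl v w (e * (b - a))))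

    -- Integrability rules out the branch in which `∫` takes its default value `0#`.
    ∫-hasIntegral : ∃ (HasIntegral f a b) → HasIntegral f a b (∫ em f a b)
    ∫-hasIntegral integrable with em {∃ (HasIntegral f a b)}
    ... | yes (_ , has)   = has
    ... | no notIntegrable = contradiction integrable notIntegrable

    ∫-near : (∀ e → 0# < e → ∃ (NearIntegral e)) → ∀ {e v} → NearIntegral e v → ∣ ∫ em f a b - v ∣ ≤ e * (b - a)
    ∫-near near v-near = ≤-respʳ (*-congʳ (+-identityˡ _))
      (nearIntegral-unique (hasIntegral⇒nearIntegral (∫-hasIntegral (nearIntegrals⇒integrable near))) v-near)

  -- Stated for an arbitrary supply of approximations, so that the witnesses
  -- are not unfolded.
  ∫-near-antiderivative : ∀ f → (approximate : ∀ e → 0# < e → ∃₂ λ n g → ∀ x → ∣ Func.to f x - bernstein n g (proj₁ x) ∣ ≤ e) →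
    ∀ n g {e} → (∀ x → ∣ Func.to f x - bernstein n g (proj₁ x) ∣ ≤ e) →
    ∀ {a b} → 0# ≤ a → a ≤ b → b ≤ 1# →
    ∣ ∫ em f a b - (antiderivative n g 0 b - antiderivative n g 0 a) ∣ ≤ e * (b - a)
  ∫-near-antiderivative f approximate n g close {a} {b} 0≤a a≤b b≤1 = ∫-near
    (λ e 0<e → let n , g , close = approximate e 0<e in _ , near n g close)
    (near n g close)
    where
    open Integral f 0≤a a≤b b≤1
    near : ∀ n g {e} → (∀ x → ∣ Func.to f x - bernstein n g (proj₁ x) ∣ ≤ e) →
           NearIntegral e (antiderivative n g 0 b - antiderivative n g 0 a)
    near n g = primitive-nearIntegral (antiderivative-resp n g 0)
      (primitive-cong (λ _ → refl) (λ _ → *-identityˡ _) (antiderivative-isPrimitive n g 0))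

  -- The polynomial is fixed before a and b, since one degree must serve the intervals of every m.
  ∫-approximation : ∀ f → LocallyClose f → ∀ e → 0# < e → ∃₂ λ n g → ∀ {a b} → 0# ≤ a → a ≤ b → b ≤ 1# →
    ∣ ∫ em f a b - (antiderivative n g 0 b - antiderivative n g 0 a) ∣ ≤ e * (b - a)
  ∫-approximation f locallyClose e 0<e =
    let approximate = Approximation.bernstein-approximation f locallyClose
        n , g , close = approximate e 0<e
    in n , g , ∫-near-antiderivative f approximate n g close

  -- Sums over blocks

  open MonoidSum ℕ.+-0-commutativeMonoid using () renaming (sum to sumℕ)
  open SubsetSum ℕ.+-0-commutativeMonoid using () renaming (∑∈ to ∑∈ℕ)

  module _ {n} (S : Subset n) where

    ∑∈-cong : ∀ {s t : Fin n → Carrier} → (∀ k → s k ≈ t k) → ∑∈ S s ≈ ∑∈ S t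
    ∑∈-cong s≈t = sum-cong-≋ λ k → if-cong (does (k ∈? S)) (s≈t k)
      where
      if-cong : ∀ β {x y} → x ≈ y → (if β then x else 0#) ≈ (if β then y else 0#)
      if-cong true  x≈y = x≈y
      if-cong false x≈y = refl

    ∑∈-+ : ∀ (s t : Fin n → Carrier) → ∑∈ S (λ k → s k + t k) ≈ ∑∈ S s + ∑∈ S t
    ∑∈-+ s t = trans (sum-cong-≋ λ k → if-+ (does (k ∈? S))) (∑-distrib-+ (λ k → if does (k ∈? S) then s k else 0#) _)
      where
      if-+ : ∀ β {x y} → (if β then x + y else 0#) ≈ (if β then x else 0#) + (if β then y else 0#)
      if-+ true  = refl
      if-+ false = sym (+-identityˡ 0#)

    ∑∈-* : ∀ c (s : Fin n → Carrier) → ∑∈ S (λ k → c * s k) ≈ c * ∑∈ S s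
    ∑∈-* c s = trans (sum-cong-≋ λ k → if-* (does (k ∈? S))) (sym (*-distribˡ-sum c (λ k → if does (k ∈? S) then s k else 0#)))
      where
      if-* : ∀ β {x} → (if β then c * x else 0#) ≈ c * (if β then x else 0#)
      if-* true  = refl
      if-* false = sym (zeroʳ c)

    -- Off S the terms on the left vanish, and u k is nonnegative because it bounds an absolute
    -- value, so u may be summed over all indices. The loss is harmless: the errors of all intervals
    -- together amount to e.
    ∣∑∈-∑∈∣≤sum : ∀ {s t u : Fin n → Carrier} → (∀ k → ∣ s k - t k ∣ ≤ u k) → ∣ ∑∈ S s - ∑∈ S t ∣ ≤ sum u
    ∣∑∈-∑∈∣≤sum {s} {t} close = ≤-respˡ (∣∣-cong (sum-minus n _ _)) (∣sum∣≤sum λ k → if-close (does (k ∈? S)) (close k))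
      where
      if-close : ∀ β {x y u} → ∣ x - y ∣ ≤ u → ∣ (if β then x else 0#) - (if β then y else 0#) ∣ ≤ u
      if-close true  close = close
      if-close false close = ≤-trans (≤-reflexive (trans (∣∣-cong (-‿inverseʳ 0#)) (nonNeg⇒∣x∣≈x ≤-refl)))
                                     (≤-trans (0≤∣x∣ _) close)

    ι-∑∈ : ∀ (s : Fin n → ℕ) → ι (∑∈ℕ S s) ≈ ∑∈ S (ι ∘ s)
    ι-∑∈ s = trans (ι-sum (λ k → if does (k ∈? S) then s k else 0)) (sum-cong-≋ λ k → ι-if (does (k ∈? S)))
      where
      ι-sum : ∀ {n} (s : Fin n → ℕ) → ι (sumℕ s) ≈ sum (ι ∘ s)
      ι-sum {zero}  s = refl
      ι-sum {suc n} s = trans (×-homo-+ 1# (s zero) _) (+-congˡ (ι-sum (s ∘ suc)))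
      ι-if : ∀ β {x} → ι (if β then x else 0) ≈ (if β then ι x else 0#)
      ι-if true  = refl
      ι-if false = refl

  -- From equal power sums to polynomials of bounded degree

  ι-^ : ∀ n k → ι (n ℕ.^ k) ≈ ι n ^ k
  ι-^ n zero    = +-identityʳ 1#
  ι-^ n (suc k) = trans (×1-homo-* n (n ℕ.^ k)) (*-congˡ (ι-^ n k))

  element : ∀ {m} → Fin m → Carrier
  element x = ι (suc (toℕ x))

  module Balance {m b r} (B : PTE m b r) where
    open PTE B

    -- Balanced functions form a linear space. Regularity puts the powers up to r in it, and hence
    -- every polynomial of degree at most r, in whatever form it is written.
    record Balanced (φ : Carrier → Carrier) : Set where
      constructor balanced
      field
        agree : ∀ i j → ∑∈ (block i) (φ ∘ element) ≈ ∑∈ (block j) (φ ∘ element)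

    balanced-cong : ∀ {φ ψ} → (∀ x → φ x ≈ ψ x) → Balanced φ → Balanced ψ
    balanced-cong φ≈ψ (balanced p) = balanced λ i j → trans (sym (∑∈-cong (block i) (φ≈ψ ∘ element)))
      (trans (p i j) (∑∈-cong (block j) (φ≈ψ ∘ element)))

    balanced-+ : ∀ {φ ψ} → Balanced φ → Balanced ψ → Balanced (λ x → φ x + ψ x)
    balanced-+ (balanced p) (balanced q) = balanced λ i j →
      trans (∑∈-+ (block i) _ _) (trans (+-cong (p i j) (q i j)) (sym (∑∈-+ (block j) _ _)))

    balanced-* : ∀ c {φ} → Balanced φ → Balanced (λ x → c * φ x)
    balanced-* c (balanced p) = balanced λ i j →
      trans (∑∈-* (block i) c _) (trans (*-congˡ (p i j)) (sym (∑∈-* (block j) c _)))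

    balanced-^ : ∀ {k} → k ℕ.≤ r → Balanced (_^ k)
    balanced-^ {k} k≤r = balanced λ i j →
      trans (sym (power i)) (trans (reflexive (≡.cong ι (isRegular k k≤r i j))) (power j))
      where
      power : ∀ i → ι (powerSum (block i) k) ≈ ∑∈ (block i) (λ x → element x ^ k)
      power i = trans (ι-∑∈ (block i) _) (∑∈-cong (block i) λ x → ι-^ (suc (toℕ x)) k)

    -- One affine factor is expanded at a time: α x feeds the power x^l, and β comes out as a
    -- scalar. The sum l + k never grows, so the binomial theorem is avoided.
    balanced-affine : ∀ α β k l → l ℕ.+ k ℕ.≤ r → Balanced (λ x → x ^ l * (α * x + β) ^ k)
    balanced-affine α β zero    l l+k≤r = balanced-cong (λ x → sym (*-identityʳ _))
      (balanced-^ (≡.subst (ℕ._≤ r) (ℕ.+-identityʳ l) l+k≤r))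
    balanced-affine α β (suc k) l l+k≤r = balanced-cong
      (λ x → solve 5 (λ α β x p q → α :* (x :* p :* q) :+ β :* (p :* q) := p :* ((α :* x :+ β) :* q))
               refl α β x (x ^ l) ((α * x + β) ^ k))
      (balanced-+ (balanced-* α (balanced-affine α β k (suc l) 1+l+k≤r))
                  (balanced-* β (balanced-affine α β k l (ℕ.<⇒≤ 1+l+k≤r))))
      where
      1+l+k≤r = ≡.subst (ℕ._≤ r) (ℕ.+-suc l k) l+k≤r

    -- n + suc k bounds the degree: integration adds one, and each recursive call lowers n by one
    -- and raises k by at most one.
    balanced-antiderivative : ∀ α β n g k → n ℕ.+ suc k ℕ.≤ r → Balanced (λ x → antiderivative n g k (α * x + β))
    balanced-antiderivative α β zero    g k 1+k≤r = balanced-* (g zero * ι (suc k) ⁻¹)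
      (balanced-cong (λ x → *-identityˡ _) (balanced-affine α β (suc k) 0 1+k≤r))
    balanced-antiderivative α β (suc n) g k 1+n+1+k≤r =
      balanced-+ (balanced-antiderivative α β n (g ∘ inject₁) k (ℕ.<⇒≤ 1+n+1+k≤r))
        (balanced-+ (balanced-antiderivative α β n (g ∘ suc) (suc k) n+2+k≤r)
          (balanced-* (- 1#) (balanced-antiderivative α β n (g ∘ inject₁) (suc k) n+2+k≤r)))
      where
      n+2+k≤r = ≡.subst (ℕ._≤ r) (≡.sym (ℕ.+-suc n (suc k))) 1+n+1+k≤r

  -- Block sums of increments and of integrals

  increment : (Carrier → Carrier) → ∀ {m} → Fin m → Carrier
  increment F {m} x = F (suc (toℕ x) /ℕ m) - F (toℕ x /ℕ m)

  balanced-increments : ∀ {m b r} (B : PTE m b r) n g → n ℕ.+ 1 ℕ.≤ r → ∀ i j →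
    ∑∈ (PTE.block B i) (increment (antiderivative n g 0)) ≈ ∑∈ (PTE.block B j) (increment (antiderivative n g 0))
  balanced-increments {m} B n g n+1≤r i j = trans (rewrite-block i) (trans (Balanced.agree φ-balanced i j) (sym (rewrite-block j)))
    where
    open Balance B
    h = ι m ⁻¹
    F = antiderivative n g 0

    φ : Carrier → Carrier
    -- An element x of [m] is one more than its index, so the left end of its interval is (x - 1) /
    -- m, that is h x - h.
    φ x = F (h * x + 0#) + - 1# * F (h * x + - h)

    φ-balanced : Balanced φ
    φ-balanced = balanced-+ (balanced-antiderivative h 0# n g 0 n+1≤r)
      (balanced-* (- 1#) (balanced-antiderivative h (- h) n g 0 n+1≤r))

    rewrite-block : ∀ i → ∑∈ (PTE.block B i) (increment F) ≈ ∑∈ (PTE.block B i) (φ ∘ element)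
    rewrite-block i = ∑∈-cong (PTE.block B i) λ x → trans
      (+-cong (antiderivative-resp n g 0 (solve 2 (λ h y → y :* h := h :* y :+ :0) refl h (element x)))
        (-‿cong (antiderivative-resp n g 0 (solve 2 (λ h y → y :* h := h :* (:1 :+ y) :+ :- h) refl h (ι (toℕ x))))))
      (+-congˡ (solve 1 (λ z → :- z := :- :1 :* z) refl _))

  -- The error on each interval is proportional to its width, and the widths telescope to 1, so the
  -- bound is free of m. Taking `suc m` makes the division by it meaningful.
  ∣blockIntegral-∑increments∣≤ : ∀ f {F e} → 0# ≤ e → (∀ {a b} → 0# ≤ a → a ≤ b → b ≤ 1# → ∣ ∫ em f a b - (F b - F a) ∣ ≤ e * (b - a)) →
    ∀ {m b r} (B : PTE (suc m) b r) j → ∣ blockIntegral em f B j - ∑∈ (PTE.block B j) (increment F) ∣ ≤ e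
  ∣blockIntegral-∑increments∣≤ f {F} {e} 0≤e close {m} B j = begin
    ∣ blockIntegral em f B j - ∑∈ (PTE.block B j) (increment F) ∣
      ≤⟨ ∣∑∈-∑∈∣≤sum (PTE.block B j) (λ x → close (0≤ι (toℕ x) ⊗ 0≤h) (*-monoʳ-≤ 0≤h (ι-mono-≤ (ℕ.n≤1+n (toℕ x)))) (at-≤1 x)) ⟩
    sum {M} (λ x → e * (suc (toℕ x) /ℕ M - toℕ x /ℕ M))
      ≈⟨ *-distribˡ-sum e (λ (x : Fin M) → suc (toℕ x) /ℕ M - toℕ x /ℕ M) ⟨
    e * sum {M} (λ x → suc (toℕ x) /ℕ M - toℕ x /ℕ M)
      ≈⟨ *-congˡ (sum-cong-≋ {M} λ x → +-congˡ {suc (toℕ x) /ℕ M} (-‿cong (reflexive (≡.cong (_/ℕ M) {toℕ x} (≡.sym (toℕ-inject₁ x)))))) ⟩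
    e * sum {M} (λ x → toℕ (suc x) /ℕ M - toℕ (inject₁ x) /ℕ M)
      ≈⟨ *-congˡ (sum-telescope M (λ x → toℕ x /ℕ M)) ⟩
    e * (toℕ (fromℕ M) /ℕ M - 0# * h)
      ≈⟨ *-congˡ (+-congʳ (trans (reflexive (≡.cong (_/ℕ M) (toℕ-fromℕ M))) (pos-inverseʳ (0<ι m)))) ⟩
    e * (1# - 0# * h)
      ≈⟨ solve 2 (λ e h → e :* (:1 :- :0 :* h) := e) refl e h ⟩
    e ∎
    where
    open ≤-Reasoning
    M = suc m
    h = ι M ⁻¹
    0≤h = <⇒≤ (⁻¹-pos (0<ι m))
    at-≤1 : ∀ x → suc (toℕ x) /ℕ M ≤ 1#
    at-≤1 x = ≤-trans (*-monoʳ-≤ 0≤h (ι-mono-≤ (toℕ<n x))) (≤-reflexive (pos-inverseʳ (0<ι m)))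

  blockIntegrals-close : (f : UnitFunction) → RealAnalytic f → ∀ ε → 0# < ε →
    ∃ λ (R : ℕ) → ∀ (r m b : ℕ) → r ≥ R → m ≥ 1 → b ≥ 1 →
    ∀ (B : PTE m b r) (i j : Fin b) → ∣ blockIntegral em f B i - blockIntegral em f B j ∣ < ε
  blockIntegrals-close f analytic ε 0<ε =
    -- A quarter of ε: each of the two blocks contributes e, and the total ½ ε leaves the inequality
    -- strict.
    let e = ½ * (½ * ε)
        0<e = ½-pos (½-pos 0<ε)
        n , g , close = ∫-approximation f (analytic⇒locallyClose f analytic) e 0<e
        near : ∀ {m b r} (B : PTE (suc m) b r) j → ∣ blockIntegral em f B j - ∑∈ (PTE.block B j) (increment (antiderivative n g 0)) ∣ ≤ e
        near = ∣blockIntegral-∑increments∣≤ f {antiderivative n g 0} (<⇒≤ 0<e) close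
    in n ℕ.+ 1 , λ { r (suc m) b r≥R _ _ B i j → ≤-<-trans
         (∣∣-triangle (near B i) (≤-respˡ
           (trans (∣x-y∣≈∣y-x∣ _ _) (∣∣-cong (+-congʳ (balanced-increments B n g r≥R j i)))) (near B j)))
         (≤-<-trans (≤-reflexive (½+½ _)) (½-< 0<ε)) }

mainTheorem16 : (em : ExcludedMiddle 0ℓ) (ℝ : CompleteOrderedField) →
    let open CompleteOrderedField ℝ
        open Analysis ℝ
    in (f : UnitFunction) → RealAnalytic f →
       ∀ (ε : Carrier) → 0# < ε →
       ∃ λ (R : ℕ) → ∀ (r m b : ℕ) → r ≥ R → m ≥ 1 → b ≥ 1 →
       ∀ (B : PTE m b r) (i j : Fin b) →
       ∣ blockIntegral em f B i - blockIntegral em f B j ∣ < ε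
mainTheorem16 = Proof.blockIntegrals-close
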